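{- We have $$A^{2134}(x,q)=1+I^{2134}(x,q)+x\left(A^{2134}(x,q)-1\right)+\frac{x}{1-xq}\left(I^{213}(x,q)-x\right).$$ Moreover, $$I^{2134}(x)=(1-x)E(x)-xC(x)-1+2x+\frac{x^2}{1-x},$$ $I^{2134}_1=1$, and for $n\ge2$, $$I^{2134}_n=E_n-E_{n-1}-C_{n-1}+1,$$ where $C_m=\frac1{m+1}\binom{2m}m$ is the $m$-th Catalan number, $C(x)=\sum_{m\ge0}C_mx^m=\frac{1-\sqrt{1-4x}}{2x}$, $E_m$ is the number of $1234$-avoiding permutations of $[m]$ ($E_0=1$) and $E(x)=\sum_{m\ge0}E_mx^m$.
   Context: For a permutation $\pi=\pi_1\cdots\pi_n$ of $[n]$, let $i_\pi$ be the smallest index $i$ with $\{\pi_1,\dots,\pi_i\}=\{1,\dots,i\}$; $\pi$ is indecomposable if $i_\pi=n$ (the empty permutation is not indecomposable). A permutation $\pi$ avoids a pattern $\tau\in\mathfrak S_k$ if no subsequence $\pi_{j_1}\cdots\pi_{j_k}$ ($j_1<\cdots<j_k$) is order-isomorphic to $\tau$. A descent of $\pi$ is an index $i$ with $\pi_i>\pi_{i+1}$. For a pattern $\sigma$, $A^\sigma_{n,i}$ (resp. $I^\sigma_{n,i}$) is the number of $\sigma$-avoiding permutations (resp. $\sigma$-avoiding indecomposable permutations) of $[n]$ with $i$ descents; $A^\sigma(x,q)=1+\sum_{n\ge1}\sum_iA^\sigma_{n,i}x^nq^i$, $I^\sigma(x,q)=\sum_{n\ge1}\sum_iI^\sigma_{n,i}x^nq^i$,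 $I^\sigma(x)=I^\sigma(x,1)=\sum_{n\ge1}I^\sigma_nx^n$. It is known that $1234$ and $2134$ are Wilf-equivalent, i.e. $E_m$ also equals the number of $2134$-avoiding permutations of $[m]$. -}

module Defs where

open import Data.Bool using (Bool; true; false; _∧_; _∨_; not; if_then_else_)
open import Data.Nat as ℕ using (ℕ; zero; suc; _∸_; _≡ᵇ_; _<ᵇ_)
open import Data.Nat.Combinatorics using (_C_)
open import Data.Nat.DivMod using (_/_)
open import Data.Bool.ListAction using (all; any)
open import Data.List using (List; []; _∷_; length; filterᵇ; take; zip; concatMap; map; _++_)
open import Data.Product using (_×_; _,_)
open import Data.Integer as ℤ using (ℤ; +_)
open import Relation.Binary.PropositionalEquality using (_≡_)

oneTo : ℕ → List ℕ
oneTo zero    = []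
oneTo (suc n) = oneTo n ++ (suc n ∷ [])

_∈ᵇ_ : ℕ → List ℕ → Bool
x ∈ᵇ xs = any (λ y → x ≡ᵇ y) xs

words : ℕ → ℕ → List (List ℕ)
words n zero    = [] ∷ []
words n (suc k) = concatMap (λ w → map (λ a → a ∷ w) (oneTo n)) (words n k)

-- a word of length n over [n] is a permutation of [n] iff every letter of [n] occurs
isPermᵇ : ℕ → List ℕ → Bool
isPermᵇ n w = all (λ j → j ∈ᵇ w) (oneTo n)

perms : ℕ → List (List ℕ)
perms n = filterᵇ (isPermᵇ n) (words n n)

subseqs : List ℕ → List (List ℕ)
subseqs []       = [] ∷ []
subseqs (x ∷ xs) = let r = subseqs xs in map (x ∷_) r ++ r

_==ᵇ_ : Bool → Bool → Bool
true  ==ᵇ b = b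
false ==ᵇ b = not b

orderIsoᵇ : List ℕ → List ℕ → Bool
orderIsoᵇ []       []       = true
orderIsoᵇ (a ∷ as) (b ∷ bs) =
  all (λ { (a' , b') → ((a ℕ.<ᵇ a') ==ᵇ (b ℕ.<ᵇ b')) ∧ ((a' ℕ.<ᵇ a) ==ᵇ (b' ℕ.<ᵇ b)) }) (zip as bs)
  ∧ orderIsoᵇ as bs
orderIsoᵇ _ _ = false

containsᵇ : List ℕ → List ℕ → Bool
containsᵇ π τ = any (λ s → (length s ≡ᵇ length τ) ∧ orderIsoᵇ s τ) (subseqs π)

avoidsᵇ : List ℕ → List ℕ → Bool
avoidsᵇ π τ = not (containsᵇ π τ)

des : List ℕ → ℕ
des (a ∷ b ∷ r) = (if b <ᵇ a then 1 else 0) ℕ.+ des (b ∷ r)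
des _           = 0

prefixIsInitialᵇ : List ℕ → ℕ → Bool
prefixIsInitialᵇ π i =
  all (λ j → j ∈ᵇ take i π) (oneTo i) ∧ all (λ v → v ∈ᵇ oneTo i) (take i π)

firstᵇ : (ℕ → Bool) → List ℕ → ℕ
firstᵇ p []       = 0
firstᵇ p (i ∷ is) = if p i then i else firstᵇ p is

-- i_π : smallest index i ∈ [1..n] with {π₁,…,πᵢ} = {1,…,i}
-- (it always exists for n ≥ 1, since i = n works; the value 0 is only
-- returned for the empty permutation)
iπ : List ℕ → ℕ
iπ π = firstᵇ (prefixIsInitialᵇ π) (oneTo (length π))

indecᵇ : List ℕ → Bool
indecᵇ []         = false
indecᵇ π@(_ ∷ _)  = iπ π ≡ᵇ length π

count : (List ℕ → Bool) → List (List ℕ) → ℕ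
count p xs = length (filterᵇ p xs)

Acount : List ℕ → ℕ → ℕ → ℕ
Acount σ n i = count (λ π → avoidsᵇ π σ ∧ (des π ≡ᵇ i)) (perms n)

Icount : List ℕ → ℕ → ℕ → ℕ
Icount σ n i = count (λ π → avoidsᵇ π σ ∧ indecᵇ π ∧ (des π ≡ᵇ i)) (perms n)

Icount1 : List ℕ → ℕ → ℕ
Icount1 σ n = count (λ π → avoidsᵇ π σ ∧ indecᵇ π) (perms n)

E : ℕ → ℕ
E m = count (λ π → avoidsᵇ π (1 ∷ 2 ∷ 3 ∷ 4 ∷ [])) (perms m)

Cat : ℕ → ℕ
Cat m = ((2 ℕ.* m) C m) / suc m

p2134 p213 : List ℕ
p2134 = 2 ∷ 1 ∷ 3 ∷ 4 ∷ []
p213  = 2 ∷ 1 ∷ 3 ∷ []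

Σ≤ : ℕ → (ℕ → ℤ) → ℤ
Σ≤ zero    f = f 0
Σ≤ (suc n) f = Σ≤ n f ℤ.+ f (suc n)

-- univariate series in x: n ↦ [xⁿ]
Ser1 : Set
Ser1 = ℕ → ℤ

-- bivariate series in x, q: (n , i) ↦ [xⁿ qⁱ]
Ser2 : Set
Ser2 = ℕ → ℕ → ℤ

infixl 6 _+₁_ _-₁_ _+₂_ _-₂_
infixl 7 _*₁_ _*₂_

_+₁_ _-₁_ _*₁_ : Ser1 → Ser1 → Ser1
(f +₁ g) n = f n ℤ.+ g n
(f -₁ g) n = f n ℤ.- g n
(f *₁ g) n = Σ≤ n (λ a → f a ℤ.* g (n ∸ a))

_+₂_ _-₂_ _*₂_ : Ser2 → Ser2 → Ser2
(f +₂ g) n i = f n i ℤ.+ g n i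
(f -₂ g) n i = f n i ℤ.- g n i
(f *₂ g) n i = Σ≤ n (λ a → Σ≤ i (λ b → f a b ℤ.* g (n ∸ a) (i ∸ b)))

δ : ℕ → ℕ → ℤ
δ m n = if m ≡ᵇ n then + 1 else + 0

one₁ x₁ : Ser1
one₁ n = δ n 0
x₁   n = δ n 1

one₂ x₂ : Ser2
one₂ n i = δ n 0 ℤ.* δ i 0
x₂   n i = δ n 1 ℤ.* δ i 0

-- 1/(1-x) = Σ_k x^k   and   1/(1-xq) = Σ_k x^k q^k
invOneMinusX : Ser1
invOneMinusX n = + 1

invOneMinusXQ : Ser2
invOneMinusXQ n i = δ n i

_≈₁_ : Ser1 → Ser1 → Set
f ≈₁ g = ∀ n → f n ≡ g n

_≈₂_ : Ser2 → Ser2 → Set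
f ≈₂ g = ∀ n i → f n i ≡ g n i

infix 4 _≈₁_ _≈₂_

A2 : List ℕ → Ser2
A2 σ zero    i = δ i 0
A2 σ (suc n) i = + Acount σ (suc n) i

I2 : List ℕ → Ser2
I2 σ zero    i = + 0
I2 σ (suc n) i = + Icount σ (suc n) i

I1 : List ℕ → Ser1
I1 σ zero    = + 0
I1 σ (suc n) = + Icount1 σ (suc n)

Eser : Ser1
Eser m = + E m

Cser : Ser1
Cser m = + Cat m

{-# OPTIONS --safe #-}
-- A decomposable 2134-avoider is 1 ⊕ β with β any nonempty 2134-avoider, or α ⊕ δ with α an
-- indecomposable 213-avoider of length at least 2 (so α contains 21) and δ nonempty decreasing; this
-- is the bivariate identity. Likewise every decomposable 213-avoider is 1 ⊕ β, so telescoping the sum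
-- over the length of δ turns the total count into the closed form.
--
-- That 1234 and 2134 are Wilf-equivalent comes from West's generating trees. Insert the successive
-- maxima, and label a permutation with the lengths X ≤ Y of its longest prefixes avoiding τ and τ ⊕ 1,
-- for τ = 21 or τ = 12. A maximum may be inserted after j letters iff j ≤ Y; the labels become
-- (X, j) if j > X, while for j ≤ X the pairs (1, Y+1), …, (X+1, Y+1) arise once each, for τ = 21 and for
-- τ = 12 alike. Forgetting Y gives the tree of 213-avoiders, counted by ballot numbers.
module Submission where

open import Defs

-- A new maximum can only be the last letter of an occurrence of τ ⊕ 1, so whether an insertion
-- creates one depends on the letters before it alone; this is why lengths of prefixes suffice as
-- labels. Each decomposition is proved as a rearrangement of lists: two duplicate-free lists with
-- the same members are permutations of each other, and one such statement yields both the count by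
-- descents and the total count. The case α = 1 has to be excluded, since 1 ⊕ δ is already of the
-- form 1 ⊕ β; this is the x subtracted from the series of indecomposable 213-avoiders. The + 1 of
-- the closed form is C_1, the lower end of the telescoping sum of C_k - C_{k-1} over k ≥ 2.

module AvoidingPermutations where

  open import Data.Bool using (Bool; true; false; T; not; _∧_; if_then_else_)
  open import Data.Bool.Properties using (T?; T-∧; T-≡; ∧-assoc)
  open import Data.Bool.ListAction using (all)
  open import Data.Empty using (⊥; ⊥-elim)
  open import Data.List hiding (all; any; find; lookup; sum)
  open import Data.List.Properties hiding (sum-++)
  open import Data.List.Membership.Propositional using (_∈_; _∉_; lose; find)
  open import Data.List.Membership.Propositional.Properties
  open import Data.List.Membership.Propositional.Properties.WithK using (unique∧set⇒bag)
  open import Data.List.Relation.Binary.BagAndSetEquality using (∼bag⇒↭)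
  open import Data.List.Relation.Binary.Permutation.Propositional
    using (_↭_; prep; ↭-refl; ↭-sym; ↭-trans; ↭-reflexive)
  open import Data.List.Relation.Binary.Permutation.Propositional.Properties
    using (∈-resp-↭; All-resp-↭; ↭-length; shift; drop-mid; filter-↭; drop-∷)
  import Data.List.Relation.Binary.Permutation.Propositional.Properties as Perm
  open import Data.List.Relation.Binary.Sublist.Propositional
    using (_⊆_; []; _∷_; ⊆-refl; ⊆-trans; ⊆-reflexive) renaming (_∷ʳ_ to skip)
  import Data.List.Relation.Binary.Sublist.Propositional as Sub
  import Data.List.Relation.Binary.Sublist.Propositional.Properties as Subₚ
  open import Data.List.Relation.Unary.All as All using (All; []; _∷_)
  import Data.List.Relation.Unary.All.Properties as Allₚ
  open import Data.List.Relation.Unary.AllPairs using (AllPairs; []; _∷_)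
  open import Data.List.Relation.Unary.Any as Any using (Any; here; there)
  import Data.List.Relation.Unary.Any.Properties as Anyₚ
  open import Data.List.Relation.Unary.Unique.Propositional using (Unique)
  import Data.List.Relation.Unary.Unique.Propositional.Properties as Uniqueₚ
  open import Data.Nat
    using (ℕ; zero; suc; _+_; _*_; _∸_; _≤_; _<_; _<ᵇ_; _≡ᵇ_; z≤n; s≤s; s≤s⁻¹; _≤?_; _≟_)
  open import Data.Nat.Combinatorics using (_C_; nCk+nC[k+1]≡[n+1]C[k+1]; nCk≡nC[n∸k])
  open import Data.Nat.DivMod using (_/_; m*n/n≡m)
  open import Data.Nat.ListAction using (sum)
  open import Data.Nat.ListAction.Properties using (sum-↭; sum-++)
  open import Data.Nat.Properties
  open import Data.Nat.Solver using (module +-*-Solver)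
  open import Data.Product using (_×_; _,_; proj₁; proj₂; ∃₂; ∃-syntax; map₂)
  open import Data.Sum using (_⊎_; inj₁; inj₂; [_,_]′)
  open import Data.Unit using (tt)
  open import Function using (_∘_; id; _⇔_; mk⇔; Equivalence)
  open import Relation.Nullary using (¬_; yes; no; contradiction; Dec; ¬?)
  open import Relation.Binary.PropositionalEquality hiding ([_])
  open Equivalence using (to; from)

  -- Boolean tests, subsequences and pattern containment

  T-not⇒¬T : ∀ {b} → T (not b) → ¬ T b
  T-not⇒¬T {false} _ ()

  ¬T⇒T-not : ∀ {b} → ¬ T b → T (not b)
  ¬T⇒T-not {false} _ = tt
  ¬T⇒T-not {true}  h = h tt

  T-cong : ∀ {b c} → (T b → T c) → (T c → T b) → b ≡ c
  T-cong {false} {false} _ _ = refl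
  T-cong {false} {true}  _ g = ⊥-elim (g tt)
  T-cong {true}  {false} f _ = ⊥-elim (f tt)
  T-cong {true}  {true}  _ _ = refl

  ⊆-++⁻ : ∀ {s} (u : List ℕ) {v} → s ⊆ u ++ v → ∃₂ λ s₁ s₂ → s ≡ s₁ ++ s₂ × s₁ ⊆ u × s₂ ⊆ v
  ⊆-++⁻ []      p = [] , _ , refl , [] , p
  ⊆-++⁻ (x ∷ u) (skip .x p) with s₁ , s₂ , refl , p₁ , p₂ ← ⊆-++⁻ u p = s₁ , s₂ , refl , skip x p₁ , p₂
  ⊆-++⁻ (x ∷ u) (refl ∷ p) with s₁ , s₂ , refl , p₁ , p₂ ← ⊆-++⁻ u p = x ∷ s₁ , s₂ , refl , refl ∷ p₁ , p₂

  ∈-subseqs⁺ : ∀ {s w} → s ⊆ w → s ∈ subseqs w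
  ∈-subseqs⁺ []         = here refl
  ∈-subseqs⁺ {w = x ∷ w} (skip .x p)  = ∈-++⁺ʳ (map (x ∷_) (subseqs w)) (∈-subseqs⁺ p)
  ∈-subseqs⁺ (refl ∷ p) = ∈-++⁺ˡ (∈-map⁺ _ (∈-subseqs⁺ p))

  ∈-subseqs⁻ : ∀ {s} w → s ∈ subseqs w → s ⊆ w
  ∈-subseqs⁻ []      (here refl) = []
  ∈-subseqs⁻ (x ∷ w) s∈ with ∈-++⁻ (map (x ∷_) (subseqs w)) s∈
  ... | inj₂ q = skip x (∈-subseqs⁻ w q)
  ... | inj₁ q with _ , r , refl ← ∈-map⁻ (x ∷_) q = refl ∷ ∈-subseqs⁻ w r

  OrderIso : List ℕ → List ℕ → Set
  OrderIso τ s = T ((length s ≡ᵇ length τ) ∧ orderIsoᵇ s τ)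

  Contains Avoids : List ℕ → List ℕ → Set
  Contains τ w = ∃[ s ] s ⊆ w × OrderIso τ s
  Avoids   τ w = ¬ Contains τ w

  containsᵇ⇒Contains : ∀ τ w → T (containsᵇ w τ) → Contains τ w
  containsᵇ⇒Contains τ w h with s , s∈ , iso ← find (Anyₚ.any⁻ _ (subseqs w) h) = s , ∈-subseqs⁻ w s∈ , iso

  Contains⇒containsᵇ : ∀ τ w → Contains τ w → T (containsᵇ w τ)
  Contains⇒containsᵇ τ w (s , s⊆w , iso) = Anyₚ.any⁺ _ (lose (∈-subseqs⁺ s⊆w) iso)

  avoidsᵇ⇒Avoids : ∀ τ w → T (avoidsᵇ w τ) → Avoids τ w
  avoidsᵇ⇒Avoids τ w h = T-not⇒¬T h ∘ Contains⇒containsᵇ τ w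

  Avoids⇒avoidsᵇ : ∀ τ w → Avoids τ w → T (avoidsᵇ w τ)
  Avoids⇒avoidsᵇ τ w h = ¬T⇒T-not (h ∘ containsᵇ⇒Contains τ w)

  Contains-⊆ : ∀ {τ u w} → u ⊆ w → Contains τ u → Contains τ w
  Contains-⊆ u⊆w (s , s⊆u , iso) = s , ⊆-trans s⊆u u⊆w , iso

  -- Occurrences of τ ⊕ 1

  <ᵇ-true : ∀ {m n} → m < n → (m <ᵇ n) ≡ true
  <ᵇ-true m<n = to T-≡ (<⇒<ᵇ m<n)

  <ᵇ-false : ∀ {m n} → n ≤ m → (m <ᵇ n) ≡ false
  <ᵇ-false {m} {n} n≤m with m <ᵇ n in eq
  ... | false = refl
  ... | true  = contradiction (<ᵇ⇒< m n (from T-≡ eq)) (≤⇒≯ n≤m)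

  compare-top⁻ : ∀ a d {b μ} → b < μ →
    T (((a <ᵇ d) ==ᵇ (b <ᵇ μ)) ∧ ((d <ᵇ a) ==ᵇ (μ <ᵇ b))) → a < d
  compare-top⁻ a d b<μ h rewrite <ᵇ-true b<μ with a <ᵇ d in eq
  ... | true = <ᵇ⇒< a d (from T-≡ eq)

  compare-top⁺ : ∀ a d {b μ} → b < μ → a < d →
    T (((a <ᵇ d) ==ᵇ (b <ᵇ μ)) ∧ ((d <ᵇ a) ==ᵇ (μ <ᵇ b)))
  compare-top⁺ a d b<μ a<d
    rewrite <ᵇ-true b<μ | <ᵇ-true a<d | <ᵇ-false (<⇒≤ b<μ) | <ᵇ-false (<⇒≤ a<d) = tt

  all-zip-∷ʳ : ∀ (f : ℕ × ℕ → Bool) as bs d μ → length as ≡ length bs →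
    T (all f (zip (as ∷ʳ d) (bs ∷ʳ μ))) ⇔ (T (all f (zip as bs)) × T (f (d , μ)))
  all-zip-∷ʳ f []       []       d μ _  = mk⇔ (λ h → tt , proj₁ (to T-∧ h)) (λ (_ , h) → from T-∧ (h , tt))
  all-zip-∷ʳ f (a ∷ as) (b ∷ bs) d μ eq = mk⇔
    (λ h → let h₁ , h₂ = to T-∧ h; h₃ , h₄ = to ih h₂ in from T-∧ (h₁ , h₃) , h₄)
    (λ (h , h₄) → let h₁ , h₃ = to T-∧ h in from T-∧ (h₁ , from ih (h₃ , h₄)))
    where ih = all-zip-∷ʳ f as bs d μ (suc-injective eq)

  -- `orderIsoᵇ` compares each letter with the later ones, while ⊕ 1 adds a letter at the end. Each
  -- front letter gains one comparison with the final pair, and as μ exceeds all of `bs`, that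
  -- comparison says precisely that the letter is below d.
  orderIsoᵇ-∷ʳ : ∀ as bs d μ → length as ≡ length bs → All (_< μ) bs →
    T (orderIsoᵇ (as ∷ʳ d) (bs ∷ʳ μ)) ⇔ (T (orderIsoᵇ as bs) × All (_< d) as)
  orderIsoᵇ-∷ʳ []       []       d μ _  _ = mk⇔ (λ _ → tt , []) (λ _ → tt)
  orderIsoᵇ-∷ʳ (a ∷ as) (b ∷ bs) d μ eq (b<μ ∷ bs<μ) = mk⇔
    (λ h → let h₁ , h₂ = to T-∧ h; h₃ , h₄ = to ih h₂; h₅ , h₆ = to (zips _) h₁
           in from T-∧ (h₅ , h₃) , compare-top⁻ a d b<μ h₆ ∷ h₄)
    (λ { (h , a<d ∷ as<d) → let h₅ , h₃ = to T-∧ h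
           in from T-∧ (from (zips _) (h₅ , compare-top⁺ a d b<μ a<d) , from ih (h₃ , as<d)) })
    where
    ih = orderIsoᵇ-∷ʳ as bs d μ (suc-injective eq) bs<μ
    zips = λ f → all-zip-∷ʳ f as bs d μ (suc-injective eq)

  length-∷ʳ : ∀ (xs : List ℕ) x → length (xs ∷ʳ x) ≡ suc (length xs)
  length-∷ʳ xs x = trans (length-++ xs) (+-comm (length xs) 1)

  OrderIso-∷ʳ⁻ : ∀ τ μ → All (_< μ) τ → ∀ s → OrderIso (τ ∷ʳ μ) s →
    ∃₂ λ s′ d → s ≡ s′ ∷ʳ d × OrderIso τ s′ × All (_< d) s′
  OrderIso-∷ʳ⁻ τ μ τ<μ s iso with initLast s
  ... | [] = ⊥-elim (subst (λ l → T ((0 ≡ᵇ l) ∧ orderIsoᵇ [] (τ ∷ʳ μ))) (length-∷ʳ τ μ) iso)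
  ... | s′ ∷ʳ′ d with h₁ , h₂ ← to (T-∧ {length (s′ ∷ʳ d) ≡ᵇ length (τ ∷ʳ μ)}) iso
    with eq ← suc-injective (trans (sym (length-∷ʳ s′ d)) (trans (≡ᵇ⇒≡ _ _ h₁) (length-∷ʳ τ μ)))
    with h₃ , h₄ ← to (orderIsoᵇ-∷ʳ s′ τ d μ eq τ<μ) h₂
    = s′ , d , refl , from T-∧ (≡⇒≡ᵇ _ _ eq , h₃) , h₄

  OrderIso-∷ʳ⁺ : ∀ τ μ → All (_< μ) τ → ∀ s d → OrderIso τ s → All (_< d) s → OrderIso (τ ∷ʳ μ) (s ∷ʳ d)
  OrderIso-∷ʳ⁺ τ μ τ<μ s d iso s<d with h₁ , h₂ ← to (T-∧ {length s ≡ᵇ length τ}) iso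
    with eq ← ≡ᵇ⇒≡ (length s) (length τ) h₁
    = from T-∧ ( ≡⇒≡ᵇ _ _ (trans (length-∷ʳ s d) (trans (cong suc eq) (sym (length-∷ʳ τ μ))))
               , from (orderIsoᵇ-∷ʳ s τ d μ eq τ<μ) (h₂ , s<d))

  -- τ ∷ʳ μ is the direct sum τ ⊕ 1 when μ exceeds all letters of τ.
  module _ (τ : List ℕ) (μ : ℕ) (τ<μ : All (_< μ) τ) where

    Contains-∷ʳ⇒Contains : ∀ {w} → Contains (τ ∷ʳ μ) w → Contains τ w
    Contains-∷ʳ⇒Contains (s , s⊆w , iso) with s′ , d , refl , iso′ , _ ← OrderIso-∷ʳ⁻ τ μ τ<μ s iso =
      s′ , ⊆-trans (Subₚ.++⁺ʳ [ d ] ⊆-refl) s⊆w , iso′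

    Contains-top⁺ : ∀ u {M v} → All (_< M) u → Contains τ u → Contains (τ ∷ʳ μ) (u ++ M ∷ v)
    Contains-top⁺ u {M} u<M (s , s⊆u , iso) =
      s ∷ʳ M , Subₚ.++⁺ s⊆u (refl ∷ Sub.minimum _) , OrderIso-∷ʳ⁺ τ μ τ<μ s M iso (Subₚ.All-resp-⊆ s⊆u u<M)

    -- The last letter of an occurrence of τ ⊕ 1 is its strict maximum. If M takes part it must be
    -- that letter, because the letters after it are smaller; the rest of the occurrence then lies
    -- in u.
    Contains-top⁻ : ∀ u {M v} → All (_< M) v → Contains (τ ∷ʳ μ) (u ++ M ∷ v) →
      Contains (τ ∷ʳ μ) (u ++ v) ⊎ Contains τ u
    Contains-top⁻ u {M} {v} v<M (s , s⊆w , iso) with ⊆-++⁻ u s⊆w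
    ... | s₁ , s₂ , refl , p₁ , (skip .M p₂) = inj₁ (s , Subₚ.++⁺ p₁ p₂ , iso)
    ... | s₁ , .M ∷ s₃ , refl , p₁ , (refl ∷ p₃)
      with s′ , d , eq , iso′ , s′<d ← OrderIso-∷ʳ⁻ τ μ τ<μ s iso with initLast s₃
    ... | [] with refl , _ ← ∷ʳ-injective s₁ s′ eq = inj₂ (s₁ , p₁ , iso′)
    ... | s₄ ∷ʳ′ e with refl , refl ← ∷ʳ-injective (s₁ ++ M ∷ s₄) s′ (trans (++-assoc s₁ (M ∷ s₄) [ e ]) eq) =
      contradiction (All.lookup s′<d (∈-++⁺ʳ s₁ (here refl)))
        (<⇒≯ (All.lookup v<M (Sub.lookup p₃ (∈-++⁺ʳ s₄ (here refl)))))

  -- Occurrences of 21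

  OrderIso-21⁻ : ∀ {s} → OrderIso (2 ∷ 1 ∷ []) s → ∃₂ λ a b → s ≡ a ∷ b ∷ [] × b < a
  OrderIso-21⁻ {[]} ()
  OrderIso-21⁻ {_ ∷ []} ()
  OrderIso-21⁻ {_ ∷ _ ∷ _ ∷ _} ()
  OrderIso-21⁻ {a ∷ b ∷ []} h with a <ᵇ b | b <ᵇ a in eq
  ... | false | true = a , b , refl , <ᵇ⇒< b a (from T-≡ eq)

  OrderIso-21⁺ : ∀ {a b} → b < a → OrderIso (2 ∷ 1 ∷ []) (a ∷ b ∷ [])
  OrderIso-21⁺ b<a rewrite <ᵇ-true b<a | <ᵇ-false (<⇒≤ b<a) = tt

  Contains-21⁻ : ∀ {w} → Contains (2 ∷ 1 ∷ []) w → ∃₂ λ a b → a ∷ b ∷ [] ⊆ w × b < a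
  Contains-21⁻ (s , s⊆w , iso) with a , b , refl , b<a ← OrderIso-21⁻ {s} iso = a , b , s⊆w , b<a

  Contains-21⁺ : ∀ {a b w} → a ∷ b ∷ [] ⊆ w → b < a → Contains (2 ∷ 1 ∷ []) w
  Contains-21⁺ p b<a = _ , p , OrderIso-21⁺ b<a

  -- Longest τ-avoiding prefixes

  -- On permutations, X is the length of the longest increasing prefix for τ = 21 and of the longest
  -- decreasing prefix for τ = 12. The guard in `maximal` covers words that avoid τ altogether.
  record LongestAvoidingPrefix (τ w : List ℕ) (X : ℕ) : Set where
    field
      bounded : X ≤ length w
      avoids  : Avoids τ (take X w)
      maximal : X < length w → Contains τ (take (suc X) w)

  open LongestAvoidingPrefix public

  ins : ℕ → ℕ → List ℕ → List ℕ
  ins j M w = take j w ++ M ∷ drop j w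

  length-ins : ∀ j M w → length (ins j M w) ≡ suc (length w)
  length-ins zero    M w       = refl
  length-ins (suc j) M []      = refl
  length-ins (suc j) M (x ∷ w) = cong suc (length-ins j M w)

  take-mono : ∀ {i j} (w : List ℕ) → i ≤ j → take i w ⊆ take j w
  take-mono w i≤j = Subₚ.take⁺ i≤j

  take-⊆ : ∀ i (w : List ℕ) → take i w ⊆ w
  take-⊆ = Subₚ.take-⊆

  take-ins-≤ : ∀ {i j} M w → i ≤ j → i ≤ length w → take i (ins j M w) ≡ take i w
  take-ins-≤ {zero}          M w       _         _         = refl
  take-ins-≤ {suc i} {suc j} M (x ∷ w) (s≤s i≤j) (s≤s i≤l) = cong (x ∷_) (take-ins-≤ M w i≤j i≤l)

  take-ins-> : ∀ {i j} M w → j ≤ i → i ≤ length w → take (suc i) (ins j M w) ≡ ins j M (take i w)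
  take-ins-> {i}     {zero}  M w       _         _         = refl
  take-ins-> {suc i} {suc j} M (x ∷ w) (s≤s j≤i) (s≤s i≤l) = cong (x ∷_) (take-ins-> M w j≤i i≤l)

  ⊆-ins : ∀ j M w → w ⊆ ins j M w
  ⊆-ins j M w = ⊆-trans (⊆-reflexive (sym (take++drop≡id j w))) (Subₚ.++⁺ ⊆-refl (skip M ⊆-refl))

  -- The first X + 1 letters decide the label, and insertion after j > X letters leaves them in
  -- place.
  lap-ins-beyond : ∀ {τ w X j} M → LongestAvoidingPrefix τ w X → X < j → j ≤ length w →
    LongestAvoidingPrefix τ (ins j M w) X
  lap-ins-beyond {τ} {w} {X} {j} M L X<j j≤l = record
    { bounded = subst (X ≤_) (sym (length-ins j M w)) (m≤n⇒m≤1+n (L .bounded))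
    ; avoids  = subst (Avoids τ) (sym (take-ins-≤ M w (<⇒≤ X<j) (L .bounded))) (L .avoids)
    ; maximal = λ _ → subst (Contains τ) (sym (take-ins-≤ M w X<j (≤-trans X<j j≤l))) (L .maximal (≤-trans X<j j≤l))
    }

  module _ (τ : List ℕ) (μ : ℕ) (τ<μ : All (_< μ) τ) {w : List ℕ} {X Y : ℕ}
           (LX : LongestAvoidingPrefix τ w X) (LY : LongestAvoidingPrefix (τ ∷ʳ μ) w Y) where

    -- Otherwise the prefix of length Y + 1, which contains τ ⊕ 1 and hence τ, would lie inside the
    -- τ-avoiding prefix of length X.
    lap-≤ : X ≤ Y
    lap-≤ with X ≤? Y
    ... | yes X≤Y = X≤Y
    ... | no  X≰Y = contradiction
      (Contains-⊆ (take-mono w (≰⇒> X≰Y)) (Contains-∷ʳ⇒Contains τ μ τ<μ (LY .maximal (<-≤-trans (≰⇒> X≰Y) (LX .bounded)))))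
      (LX .avoids)

    module _ {M : ℕ} (w<M : All (_< M) w) {j : ℕ} where

      ins-avoids : j ≤ X → Avoids (τ ∷ʳ μ) w → Avoids (τ ∷ʳ μ) (ins j M w)
      ins-avoids j≤X av c with Contains-top⁻ τ μ τ<μ (take j w) (Allₚ.drop⁺ j w<M) c
      ... | inj₁ c′ = av (subst (Contains _) (take++drop≡id j w) c′)
      ... | inj₂ c′ = LX .avoids (Contains-⊆ (take-mono w j≤X) c′)

      prefix-contains : X < j → j ≤ length w → Contains τ (take j w)
      prefix-contains X<j j≤l = Contains-⊆ (take-mono w X<j) (LX .maximal (≤-trans X<j j≤l))

      ins-contains : X < j → j ≤ length w → Contains (τ ∷ʳ μ) (ins j M w)
      ins-contains X<j j≤l = Contains-top⁺ τ μ τ<μ (take j w) (Allₚ.take⁺ j w<M) (prefix-contains X<j j≤l)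

      -- With at most X letters before it, M completes no τ ⊕ 1, so the avoiding prefix grows by M
      -- itself; one letter further, the old occurrence is still present.
      lap-ins-low : j ≤ X → LongestAvoidingPrefix (τ ∷ʳ μ) (ins j M w) (suc Y)
      lap-ins-low j≤X = record
        { bounded = subst (suc Y ≤_) (sym (length-ins j M w)) (s≤s (LY .bounded))
        ; avoids  = subst (Avoids _) (sym (take-ins-> M w (≤-trans j≤X lap-≤) (LY .bounded))) low-avoids
        ; maximal = λ Y<l → let Y<l′ = s≤s⁻¹ (subst (suc Y <_) (length-ins j M w) Y<l) in
            subst (Contains _) (sym (take-ins-> M w (m≤n⇒m≤1+n (≤-trans j≤X lap-≤)) Y<l′))
              (Contains-⊆ (⊆-ins j M (take (suc Y) w)) (LY .maximal Y<l′))
        }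
        where
        low-avoids : Avoids (τ ∷ʳ μ) (ins j M (take Y w))
        low-avoids c with Contains-top⁻ τ μ τ<μ (take j (take Y w)) (Allₚ.drop⁺ j (Allₚ.take⁺ Y w<M)) c
        ... | inj₁ c′ = LY .avoids (subst (Contains _) (take++drop≡id j (take Y w)) c′)
        ... | inj₂ c′ = LX .avoids (Contains-⊆ take-take-⊆ c′)
          where
          take-take-⊆ : take j (take Y w) ⊆ take X w
          take-take-⊆ rewrite take-take j Y w | m≤n⇒m⊓n≡m (≤-trans j≤X lap-≤) = take-mono w j≤X

      -- The first j letters are unchanged and avoid τ ⊕ 1 by j ≤ Y. By X < j they contain τ, which
      -- M, coming right after them, tops.
      lap-ins-mid : X < j → j ≤ Y → LongestAvoidingPrefix (τ ∷ʳ μ) (ins j M w) j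
      lap-ins-mid X<j j≤Y = record
        { bounded = subst (j ≤_) (sym (length-ins j M w)) (m≤n⇒m≤1+n j≤l)
        ; avoids  = subst (Avoids _) (sym (take-ins-≤ M w ≤-refl j≤l)) (LY .avoids ∘ Contains-⊆ (take-mono w j≤Y))
        ; maximal = λ _ → subst (Contains _) (sym (trans (take-ins-> M w ≤-refl j≤l) ins-end))
            (Contains-top⁺ τ μ τ<μ (take j w) {v = []} (Allₚ.take⁺ j w<M) (prefix-contains X<j j≤l))
        }
        where
        j≤l = ≤-trans j≤Y (LY .bounded)
        -- `take j w` has at most j letters, so inserting after j of them appends.
        ins-end : ins j M (take j w) ≡ take j w ∷ʳ M
        ins-end = cong₂ (λ u v → u ++ M ∷ v)
          (trans (take-take j j w) (cong (λ i → take i w) (⊓-idem j)))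
          (drop-all j (take j w) (≤-trans (≤-reflexive (length-take j w)) (m⊓n≤m j (length w))))

  -- Finite sums

  Σ< : ℕ → (ℕ → ℕ) → ℕ
  Σ< n f = sum (applyUpTo f n)

  Σ<-cong : ∀ n {f g} → (∀ j → j < n → f j ≡ g j) → Σ< n f ≡ Σ< n g
  Σ<-cong zero    h = refl
  Σ<-cong (suc n) h = cong₂ _+_ (h 0 (s≤s z≤n)) (Σ<-cong n (λ j j<n → h (suc j) (s≤s j<n)))

  Σ<-zero : ∀ n {f} → (∀ j → j < n → f j ≡ 0) → Σ< n f ≡ 0
  Σ<-zero zero    h = refl
  Σ<-zero (suc n) h = cong₂ _+_ (h 0 (s≤s z≤n)) (Σ<-zero n (λ j j<n → h (suc j) (s≤s j<n)))

  Σ<-+ : ∀ m n f → Σ< (m + n) f ≡ Σ< m f + Σ< n (λ j → f (m + j))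
  Σ<-+ zero    n f = refl
  Σ<-+ (suc m) n f = trans (cong (f 0 +_) (Σ<-+ m n (f ∘ suc))) (sym (+-assoc (f 0) _ _))

  Σ<-last : ∀ n f → Σ< (suc n) f ≡ Σ< n f + f n
  Σ<-last n f = begin
    sum (applyUpTo f (suc n))   ≡⟨ cong sum (applyUpTo-∷ʳ f n) ⟨
    sum (applyUpTo f n ∷ʳ f n)  ≡⟨ sum-++ (applyUpTo f n) [ f n ] ⟩
    Σ< n f + (f n + 0)          ≡⟨ cong (Σ< n f +_) (+-identityʳ (f n)) ⟩
    Σ< n f + f n                ∎
    where open ≡-Reasoning

  indicator : Bool → ℕ
  indicator b = if b then 1 else 0

  count-sum : ∀ p (ws : List (List ℕ)) → count p ws ≡ sum (map (indicator ∘ p) ws)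
  count-sum p []       = refl
  count-sum p (w ∷ ws) with p w
  ... | true  = cong suc (count-sum p ws)
  ... | false = count-sum p ws

  sum-map-concatMap : ∀ {A B : Set} (f : B → ℕ) (g : A → List B) xs →
    sum (map f (concatMap g xs)) ≡ sum (map (λ x → sum (map f (g x))) xs)
  sum-map-concatMap f g []       = refl
  sum-map-concatMap f g (x ∷ xs) = begin
    sum (map f (g x ++ concatMap g xs))               ≡⟨ cong sum (map-++ f (g x) _) ⟩
    sum (map f (g x) ++ map f (concatMap g xs))       ≡⟨ sum-++ (map f (g x)) _ ⟩
    sum (map f (g x)) + sum (map f (concatMap g xs))  ≡⟨ cong (sum (map f (g x)) +_) (sum-map-concatMap f g xs) ⟩
    _                                                 ∎
    where open ≡-Reasoning

  -- Permutations as lists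

  ↭-of-unique : ∀ {A : Set} {xs ys : List A} → Unique xs → Unique ys → (∀ {x} → x ∈ xs ⇔ x ∈ ys) → xs ↭ ys
  ↭-of-unique ux uy eq = ∼bag⇒↭ (unique∧set⇒bag ux uy eq)

  -- The label of an entry reveals the key of its block, so blocks with different keys are disjoint.
  unique-concatMap : ∀ {A B C : Set} (f : A → List B) (label : B → C) (key : A → C) xs →
    Unique (map key xs) → (∀ {x} → x ∈ xs → Unique (f x)) → (∀ {x y} → x ∈ xs → y ∈ f x → label y ≡ key x) →
    Unique (concatMap f xs)
  unique-concatMap f label key []       _          _  _    = []
  unique-concatMap f label key (x ∷ xs) (x# ∷ uxs) uf labf = Uniqueₚ.++⁺ (uf (here refl))
    (unique-concatMap f label key xs uxs (uf ∘ there) (λ z∈ → labf (there z∈)))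
    (λ (y∈fx , y∈rest) → let z , z∈xs , y∈fz = find (∈-concatMap⁻ f y∈rest) in
       All.lookup x# (∈-map⁺ key z∈xs) (trans (sym (labf (here refl) y∈fx)) (labf (there z∈xs) y∈fz)))

  ∈-oneTo⁺ : ∀ {j n} → 1 ≤ j → j ≤ n → j ∈ oneTo n
  ∈-oneTo⁺ {n = zero}  (s≤s _) ()
  ∈-oneTo⁺ {j} {suc n} 1≤j j≤1+n with j ≟ suc n
  ... | yes refl = ∈-++⁺ʳ (oneTo n) (here refl)
  ... | no  j≢   = ∈-++⁺ˡ (∈-oneTo⁺ 1≤j (s≤s⁻¹ (≤∧≢⇒< j≤1+n j≢)))

  ∈-oneTo⁻ : ∀ {j} n → j ∈ oneTo n → 1 ≤ j × j ≤ n
  ∈-oneTo⁻ (suc n) j∈ with ∈-++⁻ (oneTo n) j∈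
  ... | inj₁ q           = map₂ m≤n⇒m≤1+n (∈-oneTo⁻ n q)
  ... | inj₂ (here refl) = s≤s z≤n , ≤-refl

  length-oneTo : ∀ n → length (oneTo n) ≡ n
  length-oneTo zero    = refl
  length-oneTo (suc n) = trans (length-∷ʳ (oneTo n) (suc n)) (cong suc (length-oneTo n))

  unique-oneTo : ∀ n → Unique (oneTo n)
  unique-oneTo zero    = []
  unique-oneTo (suc n) = Uniqueₚ.++⁺ (unique-oneTo n) ([] ∷ [])
    λ { (p , here refl) → 1+n≰n (proj₂ (∈-oneTo⁻ n p)) }

  ∈ᵇ⇒∈ : ∀ {x} xs → T (x ∈ᵇ xs) → x ∈ xs
  ∈ᵇ⇒∈ {x} xs h = Any.map (λ {y} → ≡ᵇ⇒≡ x y) (Anyₚ.any⁻ _ xs h)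

  ∈⇒∈ᵇ : ∀ {x xs} → x ∈ xs → T (x ∈ᵇ xs)
  ∈⇒∈ᵇ {x} x∈ = Anyₚ.any⁺ _ (Any.map (λ {y} → ≡⇒≡ᵇ x y) x∈)

  ∈-words⁺ : ∀ n w → All (_∈ oneTo n) w → w ∈ words n (length w)
  ∈-words⁺ n []      []        = here refl
  ∈-words⁺ n (x ∷ w) (x∈ ∷ w∈) = ∈-concatMap⁺ _ (lose (∈-words⁺ n w w∈) (∈-map⁺ (_∷ w) x∈))

  ∈-words⁻ : ∀ n k {w} → w ∈ words n k → length w ≡ k × All (_∈ oneTo n) w
  ∈-words⁻ n zero    (here refl) = refl , []
  ∈-words⁻ n (suc k) w∈ with v , v∈ , w∈′ ← find (∈-concatMap⁻ _ {words n k} w∈)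
    with x , x∈ , refl ← ∈-map⁻ (_∷ v) w∈′ with l , a ← ∈-words⁻ n k v∈ = cong suc l , x∈ ∷ a

  unique-words : ∀ n k → Unique (words n k)
  unique-words n zero    = [] ∷ []
  unique-words n (suc k) = unique-concatMap _ (drop 1) id (words n k)
    (subst Unique (sym (map-id (words n k))) (unique-words n k))
    (λ _ → Uniqueₚ.map⁺ ∷-injectiveˡ (unique-oneTo n))
    (λ {v} _ y∈ → let _ , _ , eq = ∈-map⁻ (_∷ v) y∈ in cong (drop 1) eq)

  -- Pigeonhole: once the distinct letters of `xs` are placed in w, there is no room for others.
  -- This turns tests that only ask every letter to occur, such as `isPermᵇ`, into rearrangements.
  ↭-of-⊇ : ∀ {xs w : List ℕ} → Unique xs → (∀ {x} → x ∈ xs → x ∈ w) → length w ≤ length xs → w ↭ xs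
  ↭-of-⊇ {[]}     {[]}    _ _ _ = ↭-refl
  ↭-of-⊇ {x ∷ xs} {w} (x# ∷ u) sup len with ws , zs , refl ← ∈-∃++ (sup (here refl)) =
    ↭-trans (shift x ws zs) (prep x (↭-of-⊇ u sup′ len′))
    where
    sh : ws ++ x ∷ zs ↭ x ∷ ws ++ zs
    sh = shift x ws zs
    sup′ : ∀ {y} → y ∈ xs → y ∈ ws ++ zs
    sup′ y∈ with ∈-resp-↭ sh (sup (there y∈))
    ... | here refl = contradiction refl (All.lookup x# y∈)
    ... | there q   = q
    len′ : length (ws ++ zs) ≤ length xs
    len′ = s≤s⁻¹ (subst (_≤ suc (length xs)) (↭-length sh) len)

  IsPerm : ℕ → List ℕ → Set
  IsPerm n w = w ↭ oneTo n

  length-IsPerm : ∀ {n w} → IsPerm n w → length w ≡ n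
  length-IsPerm {n} p = trans (↭-length p) (length-oneTo n)

  letters-IsPerm : ∀ {n w} → IsPerm n w → All (λ a → 1 ≤ a × a ≤ n) w
  letters-IsPerm {n} p = All.tabulate (λ a∈ → ∈-oneTo⁻ n (∈-resp-↭ p a∈))

  ∈-perms⁻ : ∀ n {w} → w ∈ perms n → IsPerm n w
  ∈-perms⁻ n {w} w∈ with w∈words , h ← ∈-filter⁻ (T? ∘ isPermᵇ n) {xs = words n n} w∈ = ↭-of-⊇ (unique-oneTo n)
    (λ x∈ → ∈ᵇ⇒∈ w (All.lookup (Allₚ.all⁺ _ (oneTo n) h) x∈))
    (≤-reflexive (trans (proj₁ (∈-words⁻ n n w∈words)) (sym (length-oneTo n))))

  ∈-perms⁺ : ∀ n {w} → IsPerm n w → w ∈ perms n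
  ∈-perms⁺ n {w} p = ∈-filter⁺ (T? ∘ isPermᵇ n)
    (subst (λ k → w ∈ words n k) (length-IsPerm {n} p) (∈-words⁺ n w (All.tabulate (∈-resp-↭ p))))
    (Allₚ.all⁻ _ (All.tabulate (λ x∈ → ∈⇒∈ᵇ (∈-resp-↭ (↭-sym p) x∈))))

  unique-perms : ∀ n → Unique (perms n)
  unique-perms n = Uniqueₚ.filter⁺ (T? ∘ isPermᵇ n) (unique-words n n)

  -- Permutations grown by inserting maxima

  insertions : ℕ → List ℕ → List (List ℕ)
  insertions M w = applyUpTo (λ j → ins j M w) (suc (length w))

  ins-↭ : ∀ j M w → ins j M w ↭ M ∷ w
  ins-↭ j M w = ↭-trans (shift M (take j w) (drop j w)) (↭-reflexive (cong (M ∷_) (take++drop≡id j w)))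

  ins-at-length : ∀ M u v → ins (length u) M (u ++ v) ≡ u ++ M ∷ v
  ins-at-length M []      v = refl
  ins-at-length M (x ∷ u) v = cong (x ∷_) (ins-at-length M u v)

  ins-injective : ∀ {M w i j} → M ∉ w → i ≤ length w → j ≤ length w → ins i M w ≡ ins j M w → i ≡ j
  ins-injective {i = zero}  {zero}  _ _ _ _ = refl
  ins-injective {w = x ∷ w} {zero}  {suc j} M∉ _ _ eq = contradiction (here (∷-injectiveˡ eq)) M∉
  ins-injective {w = x ∷ w} {suc i} {zero}  M∉ _ _ eq = contradiction (here (sym (∷-injectiveˡ eq))) M∉
  ins-injective {w = x ∷ w} {suc i} {suc j} M∉ (s≤s i≤) (s≤s j≤) eq =
    cong suc (ins-injective (M∉ ∘ there) i≤ j≤ (∷-injectiveʳ eq))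

  remove : ℕ → List ℕ → List ℕ
  remove M = filter (λ x → ¬? (x ≟ M))

  remove-ins : ∀ M w j → M ∉ w → remove M (ins j M w) ≡ w
  remove-ins M w j M∉ = begin
    remove M (take j w ++ M ∷ drop j w)         ≡⟨ filter-++ P? (take j w) (M ∷ drop j w) ⟩
    remove M (take j w) ++ remove M (M ∷ drop j w)
      ≡⟨ cong (remove M (take j w) ++_) (filter-reject P? {M} {drop j w} (λ ne → ne refl)) ⟩
    remove M (take j w) ++ remove M (drop j w)
      ≡⟨ cong₂ _++_ (filter-all P? (Allₚ.take⁺ j ≢M)) (filter-all P? (Allₚ.drop⁺ j ≢M)) ⟩
    take j w ++ drop j w                        ≡⟨ take++drop≡id j w ⟩
    w                                           ∎
    where
    open ≡-Reasoning
    P? = λ x → ¬? (x ≟ M)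
    ≢M : All (_≢ M) w
    ≢M = All.tabulate (λ x∈ → λ { refl → M∉ x∈ })

  suc∉perm : ∀ {n w} → w ∈ perms n → suc n ∉ w
  suc∉perm {n} w∈ n∈ = 1+n≰n (proj₂ (All.lookup (letters-IsPerm (∈-perms⁻ n w∈)) n∈))

  -- `words` builds permutations letter by letter, the trees by successive maxima; comparing members
  -- bridges the two. Removing n + 1 recovers the parent, which keeps the blocks of different
  -- parents disjoint.
  perms-suc : ∀ n → perms (suc n) ↭ concatMap (insertions (suc n)) (perms n)
  perms-suc n = ↭-of-unique (unique-perms (suc n))
    (unique-concatMap (insertions (suc n)) (remove (suc n)) id (perms n)
      (subst Unique (sym (map-id (perms n))) (unique-perms n))
      (λ {w} w∈ → Uniqueₚ.applyUpTo⁺₁ (λ j → ins j (suc n) w) _ λ i<j j<l eq →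
         <⇒≢ i<j (ins-injective (suc∉perm w∈) (s≤s⁻¹ (<-trans i<j j<l)) (s≤s⁻¹ j<l) eq))
      (λ {w} w∈ v∈ → let j , _ , eq = ∈-applyUpTo⁻ (λ j → ins j (suc n) w) v∈ in
         trans (cong (remove (suc n)) eq) (remove-ins (suc n) w j (suc∉perm w∈))))
    (mk⇔ forth back)
    where
    forth : ∀ {w} → w ∈ perms (suc n) → w ∈ concatMap (insertions (suc n)) (perms n)
    forth w∈ with p ← ∈-perms⁻ (suc n) w∈
      with u , v , refl ← ∈-∃++ (∈-resp-↭ (↭-sym p) (∈-++⁺ʳ (oneTo n) (here refl))) =
      ∈-concatMap⁺ (insertions (suc n)) (lose
        (∈-perms⁺ n (↭-trans (drop-mid u (oneTo n) p) (↭-reflexive (++-identityʳ (oneTo n)))))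
        (subst (_∈ insertions (suc n) (u ++ v)) (ins-at-length (suc n) u v)
          (∈-applyUpTo⁺ (λ j → ins j (suc n) (u ++ v))
            (s≤s (≤-trans (m≤m+n (length u) (length v)) (≤-reflexive (sym (length-++ u))))))))
    back : ∀ {w} → w ∈ concatMap (insertions (suc n)) (perms n) → w ∈ perms (suc n)
    back w∈ with v , v∈ , w∈′ ← find (∈-concatMap⁻ (insertions (suc n)) {perms n} w∈)
      with j , _ , refl ← ∈-applyUpTo⁻ (λ j → ins j (suc n) v) w∈′ = ∈-perms⁺ (suc n)
        (↭-trans (ins-↭ j (suc n) v) (↭-trans (prep (suc n) (∈-perms⁻ n v∈)) (Perm.∷↭∷ʳ (suc n) (oneTo n))))

  -- The number of words satisfying p that arise from w by inserting n+1, …, n+m in turn.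
  descendants : (List ℕ → Bool) → ℕ → ℕ → List ℕ → ℕ
  descendants p zero    n w = indicator (p w)
  descendants p (suc m) n w = Σ< (suc (length w)) (λ j → descendants p m (suc n) (ins j (suc n) w))

  -- The induction on m leaves n free: each step moves one layer of insertions from `perms` into
  -- `descendants`.
  count-perms-+ : ∀ p m n → count p (perms (m + n)) ≡ sum (map (descendants p m n) (perms n))
  count-perms-+ p zero    n = count-sum p (perms n)
  count-perms-+ p (suc m) n = begin
    count p (perms (suc m + n))                                 ≡⟨ cong (count p ∘ perms) (+-suc m n) ⟨
    count p (perms (m + suc n))                                 ≡⟨ count-perms-+ p m (suc n) ⟩
    sum (map D (perms (suc n)))                                 ≡⟨ sum-↭ (Perm.map⁺ D (perms-suc n)) ⟩
    sum (map D (concatMap (insertions (suc n)) (perms n)))      ≡⟨ sum-map-concatMap D (insertions (suc n)) (perms n) ⟩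
    sum (map (λ w → sum (map D (insertions (suc n) w))) (perms n))
      ≡⟨ cong sum (map-cong (λ w → cong sum (map-applyUpTo (λ j → ins j (suc n) w) D (suc (length w)))) (perms n)) ⟩
    sum (map (descendants p (suc m) n) (perms n))               ∎
    where
    open ≡-Reasoning
    D = descendants p m (suc n)

  count-perms : ∀ p n → count p (perms n) ≡ descendants p n 0 []
  count-perms p n = trans (cong (count p ∘ perms) (sym (+-identityʳ n)))
    (trans (count-perms-+ p n 0) (+-identityʳ _))

  -- Generating trees

  avoiders : List ℕ → List ℕ → Bool
  avoiders τ w = avoidsᵇ w τ

  ins-letters : ∀ {n w} j → All (_≤ n) w → All (_≤ suc n) (ins j (suc n) w)
  ins-letters j w≤n = Allₚ.++⁺ (Allₚ.take⁺ j w≤1+n) (≤-refl ∷ Allₚ.drop⁺ j w≤1+n)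
    where w≤1+n = All.map m≤n⇒m≤1+n w≤n

  -- Insertions never destroy an occurrence, so nothing below such a node is counted.
  descendants-containing : ∀ τ m n w → Contains τ w → descendants (avoiders τ) m n w ≡ 0
  descendants-containing τ zero    n w c with containsᵇ w τ | Contains⇒containsᵇ τ w c
  ... | true | _ = refl
  descendants-containing τ (suc m) n w c = Σ<-zero (suc (length w)) λ j _ →
    descendants-containing τ m (suc n) (ins j (suc n) w) (Contains-⊆ (⊆-ins j (suc n) w) c)

  indicator-avoiding : ∀ τ w → Avoids τ w → indicator (avoiders τ w) ≡ 1
  indicator-avoiding τ w av with avoidsᵇ w τ | Avoids⇒avoidsᵇ τ w av
  ... | true | _ = refl

  -- Numbers of descendants after m insertions below a node with labels X, respectively (X, Y).
  catalanTree : ℕ → ℕ → ℕ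
  catalanTree zero    X = 1
  catalanTree (suc m) X = Σ< (suc X) (λ j → catalanTree m (suc j))

  westTree : ℕ → ℕ → ℕ → ℕ
  westTree zero    X Y = 1
  westTree (suc m) X Y = Σ< (suc X) (λ j → westTree m (suc j) (suc Y)) + Σ< (Y ∸ X) (λ j → westTree m X (suc X + j))

  -- The base pattern enters through `child X j`, the first label after an insertion at j ≤ X.
  -- `Σ<-child` expresses that these labels are 1, ..., X + 1 in some order; the order may depend on
  -- τ, the sums over subtrees do not.
  module GeneratingTree
    (τ : List ℕ) (child : ℕ → ℕ → ℕ)
    (lap-child : ∀ {w X M j} → LongestAvoidingPrefix τ w X → All (_< M) w → j ≤ X →
       LongestAvoidingPrefix τ (ins j M w) (child X j))
    (Σ<-child : ∀ X f → Σ< (suc X) (f ∘ child X) ≡ Σ< (suc X) (f ∘ suc))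
    (μ : ℕ) (τ<μ : All (_< μ) τ)
    where

    split-at : ∀ {X l} (f : ℕ → ℕ) → X ≤ l → Σ< (suc l) f ≡ Σ< (suc X) f + Σ< (l ∸ X) (λ j → f (suc X + j))
    split-at {X} {l} f X≤l = trans (cong (λ k → Σ< (suc k) f) (sym (m+[n∸m]≡n X≤l))) (Σ<-+ (suc X) (l ∸ X) f)

    beyond : ∀ {X l j} → X ≤ l → j < l ∸ X → suc X + j ≤ l
    beyond {X} {l} {j} X≤l j< = subst (_≤ l) (cong suc (+-comm j X)) (m≤o∸n⇒m+n≤o (suc j) X≤l j<)

    -- Sites beyond X complete τ ⊕ 1 and contribute nothing; the sites 0, ..., X have the children
    -- prescribed by `catalanTree`, up to order.
    descendants-⊕1 : ∀ m n w {X Y} → All (_≤ n) w → Avoids (τ ∷ʳ μ) w →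
      LongestAvoidingPrefix τ w X → LongestAvoidingPrefix (τ ∷ʳ μ) w Y →
      descendants (avoiders (τ ∷ʳ μ)) m n w ≡ catalanTree m X
    descendants-⊕1 zero    n w w≤n av LX LY = indicator-avoiding _ w av
    descendants-⊕1 (suc m) n w {X} {Y} w≤n av LX LY = begin
      Σ< (suc (length w)) D                                        ≡⟨ split-at D (LX .bounded) ⟩
      Σ< (suc X) D + Σ< (length w ∸ X) (λ j → D (suc X + j))       ≡⟨ cong₂ _+_ (Σ<-cong (suc X) low) (Σ<-zero (length w ∸ X) high) ⟩
      Σ< (suc X) (catalanTree m ∘ child X) + 0                     ≡⟨ +-identityʳ _ ⟩
      Σ< (suc X) (catalanTree m ∘ child X)                         ≡⟨ Σ<-child X (catalanTree m) ⟩
      catalanTree (suc m) X                                        ∎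
      where
      open ≡-Reasoning
      w<M = All.map s≤s w≤n
      D : ℕ → ℕ
      D j = descendants (avoiders (τ ∷ʳ μ)) m (suc n) (ins j (suc n) w)
      low : ∀ j → j < suc X → D j ≡ catalanTree m (child X j)
      low j (s≤s j≤X) = descendants-⊕1 m (suc n) (ins j (suc n) w) (ins-letters j w≤n)
        (ins-avoids τ μ τ<μ LX LY w<M j≤X av) (lap-child LX w<M j≤X) (lap-ins-low τ μ τ<μ LX LY w<M j≤X)
      high : ∀ j → j < length w ∸ X → D (suc X + j) ≡ 0
      high j j< = descendants-containing _ m (suc n) (ins (suc X + j) (suc n) w)
        (ins-contains τ μ τ<μ LX LY w<M (s≤s (m≤m+n X j)) (beyond (LX .bounded) j<))

    -- The sites form three blocks. Up to X the second label becomes Y + 1; from X + 1 to Y the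
    -- first label stays and the second becomes the site; beyond Y the forbidden pattern is
    -- complete. The insertion lemmas serve twice, once for τ and μ and once for τ ⊕ 1 and ν.
    descendants-⊕12 : ∀ ν → All (_< ν) (τ ∷ʳ μ) → ∀ m n w {X Y Z} → All (_≤ n) w → Avoids (τ ∷ʳ μ ∷ʳ ν) w →
      LongestAvoidingPrefix τ w X → LongestAvoidingPrefix (τ ∷ʳ μ) w Y → LongestAvoidingPrefix (τ ∷ʳ μ ∷ʳ ν) w Z →
      descendants (avoiders (τ ∷ʳ μ ∷ʳ ν)) m n w ≡ westTree m X Y
    descendants-⊕12 ν τμ<ν zero    n w w≤n av LX LY LZ = indicator-avoiding _ w av
    descendants-⊕12 ν τμ<ν (suc m) n w {X} {Y} {Z} w≤n av LX LY LZ = begin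
      Σ< (suc (length w)) D
        ≡⟨ split-at D (LY .bounded) ⟩
      Σ< (suc Y) D + Σ< (length w ∸ Y) (λ j → D (suc Y + j))
        ≡⟨ cong₂ _+_ (split-at D X≤Y) (Σ<-zero (length w ∸ Y) high) ⟩
      (Σ< (suc X) D + Σ< (Y ∸ X) (λ j → D (suc X + j))) + 0
        ≡⟨ +-identityʳ _ ⟩
      Σ< (suc X) D + Σ< (Y ∸ X) (λ j → D (suc X + j))
        ≡⟨ cong₂ _+_ (Σ<-cong (suc X) low) (Σ<-cong (Y ∸ X) mid) ⟩
      Σ< (suc X) (λ j → westTree m (child X j) (suc Y)) + Σ< (Y ∸ X) (λ j → westTree m X (suc X + j))
        ≡⟨ cong (_+ Σ< (Y ∸ X) (λ j → westTree m X (suc X + j))) (Σ<-child X (λ X′ → westTree m X′ (suc Y))) ⟩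
      westTree (suc m) X Y ∎
      where
      open ≡-Reasoning
      w<M = All.map s≤s w≤n
      X≤Y = lap-≤ τ μ τ<μ LX LY
      D : ℕ → ℕ
      D j = descendants (avoiders (τ ∷ʳ μ ∷ʳ ν)) m (suc n) (ins j (suc n) w)
      step : ∀ j {X′ Y′} → j ≤ Y → LongestAvoidingPrefix τ (ins j (suc n) w) X′ →
        LongestAvoidingPrefix (τ ∷ʳ μ) (ins j (suc n) w) Y′ → D j ≡ westTree m X′ Y′
      step j j≤Y LX′ LY′ = descendants-⊕12 ν τμ<ν m (suc n) (ins j (suc n) w) (ins-letters j w≤n)
        (ins-avoids (τ ∷ʳ μ) ν τμ<ν LY LZ w<M j≤Y av) LX′ LY′ (lap-ins-low (τ ∷ʳ μ) ν τμ<ν LY LZ w<M j≤Y)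
      low : ∀ j → j < suc X → D j ≡ westTree m (child X j) (suc Y)
      low j (s≤s j≤X) = step j (≤-trans j≤X X≤Y) (lap-child LX w<M j≤X) (lap-ins-low τ μ τ<μ LX LY w<M j≤X)
      mid : ∀ j → j < Y ∸ X → D (suc X + j) ≡ westTree m X (suc X + j)
      mid j j< = step (suc X + j) (beyond X≤Y j<)
        (lap-ins-beyond (suc n) LX (s≤s (m≤m+n X j)) (≤-trans (beyond X≤Y j<) (LY .bounded)))
        (lap-ins-mid τ μ τ<μ LX LY w<M (s≤s (m≤m+n X j)) (beyond X≤Y j<))
      high : ∀ j → j < length w ∸ Y → D (suc Y + j) ≡ 0
      high j j< = descendants-containing _ m (suc n) (ins (suc Y + j) (suc n) w)
        (ins-contains (τ ∷ʳ μ) ν τμ<ν LY LZ w<M (s≤s (m≤m+n Y j)) (beyond (LY .bounded) j<))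

  -- The generating trees of 21 and 12

  lap-[] : ∀ a τ → LongestAvoidingPrefix (a ∷ τ) [] 0
  lap-[] a τ = record { bounded = z≤n ; avoids = λ { ([] , _ , ()) ; (_ ∷ _ , () , _) } ; maximal = λ () }

  avoids-[] : ∀ a τ → Avoids (a ∷ τ) []
  avoids-[] a τ = lap-[] a τ .avoids

  take-suc-ins : ∀ {j} M w → j ≤ length w → take (suc j) (ins j M w) ≡ take j w ∷ʳ M
  take-suc-ins {zero}  M w       _         = refl
  take-suc-ins {suc j} M (x ∷ w) (s≤s j≤l) = cong (x ∷_) (take-suc-ins M w j≤l)

  ins-before-letter : ∀ {j} M w → j < length w → ∃[ y ] y ∈ w × M ∷ y ∷ [] ⊆ take (2 + j) (ins j M w)
  ins-before-letter {zero}  M (x ∷ w) _         = x , here refl , ⊆-refl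
  ins-before-letter {suc j} M (x ∷ w) (s≤s j<l) with y , y∈ , p ← ins-before-letter M w j<l = y , there y∈ , skip x p

  -- 21 does not have the form τ ⊕ 1, hence a direct argument: the first j letters avoid 21 and M
  -- extends them, but any letter following M is smaller.
  lap-21-child : ∀ {w X M j} → LongestAvoidingPrefix (2 ∷ 1 ∷ []) w X → All (_< M) w → j ≤ X →
    LongestAvoidingPrefix (2 ∷ 1 ∷ []) (ins j M w) (suc j)
  lap-21-child {w} {X} {M} {j} L w<M j≤X = record
    { bounded = subst (suc j ≤_) (sym (length-ins j M w)) (s≤s j≤l)
    ; avoids  = subst (Avoids (2 ∷ 1 ∷ [])) (sym (take-suc-ins M w j≤l)) avoids′
    ; maximal = λ j< → let y , y∈ , p = ins-before-letter M w (s≤s⁻¹ (subst (suc j <_) (length-ins j M w) j<))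
                       in Contains-21⁺ p (All.lookup w<M y∈)
    }
    where
    j≤l = ≤-trans j≤X (L .bounded)
    avoids′ : Avoids (2 ∷ 1 ∷ []) (take j w ∷ʳ M)
    avoids′ c with a , b , p , b<a ← Contains-21⁻ {take j w ∷ʳ M} c with ⊆-++⁻ (take j w) p
    ... | a ∷ b ∷ [] , [] , refl , q , _ = L .avoids (Contains-⊆ (take-mono w j≤X) (Contains-21⁺ q b<a))
    ... | a ∷ [] , b ∷ [] , refl , q , (refl ∷ _) =
      <⇒≯ b<a (All.lookup w<M (Sub.lookup (take-⊆ j w) (Sub.lookup q (here refl))))
    ... | [] , a ∷ b ∷ [] , refl , _ , (refl ∷ ())
    ... | [] , a ∷ b ∷ [] , refl , _ , skip _ ()

  lap-1 : ∀ w → LongestAvoidingPrefix (1 ∷ []) w 0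
  lap-1 w = record { bounded = z≤n ; avoids = avoids-[] 1 [] ; maximal = first-letter w }
    where
    first-letter : ∀ w → 0 < length w → Contains (1 ∷ []) (take 1 w)
    first-letter (x ∷ w) _ = x ∷ [] , ⊆-refl , tt

  -- A maximum put in front prolongs the decreasing prefix; after j + 1 letters it makes an ascent there.
  child-12 : ℕ → ℕ → ℕ
  child-12 X zero    = suc X
  child-12 X (suc j) = suc j

  -- 12 is 1 ⊕ 1, and the longest prefix avoiding the pattern 1 is empty. So the general insertion
  -- lemmas apply with first label 0: j = 0 is the low case, j > 0 the middle one.
  lap-12-child : ∀ {w X M j} → LongestAvoidingPrefix (1 ∷ 2 ∷ []) w X → All (_< M) w → j ≤ X →
    LongestAvoidingPrefix (1 ∷ 2 ∷ []) (ins j M w) (child-12 X j)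
  lap-12-child {w} {j = zero}  L w<M _   = lap-ins-low (1 ∷ []) 2 (≤-refl ∷ []) (lap-1 w) L w<M z≤n
  lap-12-child {w} {j = suc j} L w<M j≤X = lap-ins-mid (1 ∷ []) 2 (≤-refl ∷ []) (lap-1 w) L w<M (s≤s z≤n) j≤X

  module Tree-21 = GeneratingTree (2 ∷ 1 ∷ []) (λ _ j → suc j) lap-21-child (λ _ _ → refl)
    3 (≤-refl ∷ s≤s (s≤s z≤n) ∷ [])
  module Tree-12 = GeneratingTree (1 ∷ 2 ∷ []) child-12 lap-12-child
    -- For 12 the label X + 1 belongs to j = 0 and comes first; moved to the end, it restores the
    -- order 1, ..., X + 1.
    (λ X f → trans (+-comm (f (suc X)) _) (sym (Σ<-last X (f ∘ suc))))
    3 (s≤s (s≤s z≤n) ∷ ≤-refl ∷ [])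

  count-213 : ∀ n → count (avoiders p213) (perms n) ≡ catalanTree n 0
  count-213 n = trans (count-perms (avoiders p213) n)
    (Tree-21.descendants-⊕1 n 0 [] [] (avoids-[] 2 _) (lap-[] 2 _) (lap-[] 2 _))

  -- Both sides are the size of level n in the same tree, rooted at the labels (0, 0) of the empty
  -- permutation.
  wilf-1234-2134 : ∀ n → count (avoiders p2134) (perms n) ≡ E n
  wilf-1234-2134 n = begin
    count (avoiders p2134) (perms n)     ≡⟨ count-perms (avoiders p2134) n ⟩
    descendants (avoiders p2134) n 0 []  ≡⟨ Tree-21.descendants-⊕12 4 (s≤s (s≤s (s≤s z≤n)) ∷ s≤s (s≤s z≤n) ∷ ≤-refl ∷ [])
      n 0 [] [] (avoids-[] 2 _) (lap-[] 2 _) (lap-[] 2 _) (lap-[] 2 _) ⟩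
    westTree n 0 0                       ≡⟨ Tree-12.descendants-⊕12 4 (s≤s (s≤s z≤n) ∷ s≤s (s≤s (s≤s z≤n)) ∷ ≤-refl ∷ [])
      n 0 [] [] (avoids-[] 1 _) (lap-[] 1 _) (lap-[] 1 _) (lap-[] 1 _) ⟨
    descendants (avoiders (1 ∷ 2 ∷ 3 ∷ 4 ∷ [])) n 0 []  ≡⟨ count-perms (avoiders (1 ∷ 2 ∷ 3 ∷ 4 ∷ [])) n ⟨
    E n                                  ∎
    where open ≡-Reasoning

  -- Catalan numbers

  -- The absorption identity (k+1) C(n,k+1) = (n-k) C(n,k), freed of subtraction.
  k*nCk : ∀ n k → suc k * (n C suc k) + k * (n C k) ≡ n * (n C k)
  k*nCk zero    zero    = refl
  k*nCk zero    (suc k) = cong₂ _+_ (*-zeroʳ (suc (suc k))) (*-zeroʳ (suc k))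
  k*nCk (suc n) zero    = begin
    1 * (suc n C 1) + 0          ≡⟨ +-identityʳ _ ⟩
    1 * (suc n C 1)              ≡⟨ cong (1 *_) (nCk+nC[k+1]≡[n+1]C[k+1] n 0) ⟨
    1 * (1 + n C 1)              ≡⟨ *-distribˡ-+ 1 1 (n C 1) ⟩
    1 + 1 * (n C 1)              ≡⟨ cong suc (+-identityʳ _) ⟨
    1 + (1 * (n C 1) + 0)        ≡⟨ cong suc (k*nCk n zero) ⟩
    suc n * 1                    ∎
    where open ≡-Reasoning
  k*nCk (suc n) (suc k) = begin
    (2 + k) * (suc n C (2 + k)) + (1 + k) * (suc n C (1 + k))
      ≡⟨ cong₂ (λ x y → (2 + k) * x + (1 + k) * y) (nCk+nC[k+1]≡[n+1]C[k+1] n (suc k)) (nCk+nC[k+1]≡[n+1]C[k+1] n k) ⟨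
    (2 + k) * (b + c) + (1 + k) * (a + b)
      ≡⟨ solve 4 (λ k a b c → (con 2 :+ k) :* (b :+ c) :+ (con 1 :+ k) :* (a :+ b)
                    := ((con 2 :+ k) :* c :+ (con 1 :+ k) :* b) :+ ((con 1 :+ k) :* b :+ k :* a) :+ (a :+ b)) refl k a b c ⟩
    ((2 + k) * c + (1 + k) * b) + ((1 + k) * b + k * a) + (a + b)
      ≡⟨ cong₂ (λ x y → x + y + (a + b)) (k*nCk n (suc k)) (k*nCk n k) ⟩
    n * b + n * a + (a + b)
      ≡⟨ solve 3 (λ n a b → n :* b :+ n :* a :+ (a :+ b) := (con 1 :+ n) :* (a :+ b)) refl n a b ⟩
    suc n * (a + b)
      ≡⟨ cong (suc n *_) (nCk+nC[k+1]≡[n+1]C[k+1] n k) ⟩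
    suc n * (suc n C suc k) ∎
    where
    open ≡-Reasoning
    open +-*-Solver
    a = n C k
    b = n C suc k
    c = n C suc (suc k)

  -- The binomial coefficient of n over k - 1. At k = 0 it must be 0, where truncated subtraction
  -- would give 1; then Pascal's rule holds for every k.
  _Cpred_ : ℕ → ℕ → ℕ
  n Cpred zero  = 0
  n Cpred suc k = n C k

  pascal : ∀ n k → n Cpred k + n C k ≡ suc n C k
  pascal n zero    = refl
  pascal n (suc k) = nCk+nC[k+1]≡[n+1]C[k+1] n k

  C-central : ∀ k → suc (2 * k) C k ≡ suc (2 * k) C suc k
  C-central k = trans (nCk≡nC[n∸k] k≤) (cong (suc (2 * k) C_) eq)
    where
    k≤ : k ≤ suc (2 * k)
    k≤ = m≤n⇒m≤1+n (m≤m+n k _)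
    eq : suc (2 * k) ∸ k ≡ suc k
    eq = trans (cong (λ z → suc (k + z) ∸ k) (+-identityʳ k)) (trans (cong (_∸ k) (sym (+-suc k k))) (m+n∸m≡n k (suc k)))

  -- Ballot numbers as differences of adjacent binomials. Passing from X to X + 1 adds to the sum
  -- over children the subtree of label X + 2, which is matched by Pascal's rule; at X = 0 the
  -- symmetry of the two middle binomials closes the induction.
  catalanTree-ballot : ∀ m X → catalanTree m X + (2 * m + X) Cpred m ≡ (2 * m + X) C m
  catalanTree-ballot zero    X    = refl
  catalanTree-ballot (suc m) zero = begin
    catalanTree m 1 + 0 + (2 * suc m + 0) C m
      ≡⟨ cong₂ (λ x y → x + y C m) (+-identityʳ (catalanTree m 1)) n≡ ⟩
    catalanTree m 1 + suc (suc (2 * m)) C m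
      ≡⟨ cong (catalanTree m 1 +_) (pascal (suc (2 * m)) m) ⟨
    catalanTree m 1 + (suc (2 * m) Cpred m + suc (2 * m) C m)
      ≡⟨ +-assoc (catalanTree m 1) _ _ ⟨
    catalanTree m 1 + suc (2 * m) Cpred m + suc (2 * m) C m
      ≡⟨ cong (_+ suc (2 * m) C m) (subst (λ n → catalanTree m 1 + n Cpred m ≡ n C m) (+-comm (2 * m) 1) (catalanTree-ballot m 1)) ⟩
    suc (2 * m) C m + suc (2 * m) C m
      ≡⟨ cong (suc (2 * m) C m +_) (C-central m) ⟩
    suc (2 * m) C m + suc (2 * m) C suc m
      ≡⟨ nCk+nC[k+1]≡[n+1]C[k+1] (suc (2 * m)) m ⟩
    suc (suc (2 * m)) C suc m
      ≡⟨ cong (_C suc m) n≡ ⟨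
    (2 * suc m + 0) C suc m ∎
    where
    open ≡-Reasoning
    n≡ : 2 * suc m + 0 ≡ suc (suc (2 * m))
    n≡ = trans (+-identityʳ _) (*-suc 2 m)
  catalanTree-ballot (suc m) (suc X) = begin
    catalanTree (suc m) (suc X) + (2 * suc m + suc X) C m
      ≡⟨ cong₂ (λ x y → x + y C m) (Σ<-last (suc X) (λ j → catalanTree m (suc j))) (+-suc (2 * suc m) X) ⟩
    (H + K) + suc n C m             ≡⟨ cong ((H + K) +_) (pascal n m) ⟨
    (H + K) + (n Cpred m + n C m)   ≡⟨ solve 4 (λ h k p c → (h :+ k) :+ (p :+ c) := (k :+ p) :+ (h :+ c)) refl H K (n Cpred m) (n C m) ⟩
    (K + n Cpred m) + (H + n C m)   ≡⟨ cong₂ _+_ (subst (λ n → K + n Cpred m ≡ n C m) n≡ (catalanTree-ballot m (suc (suc X)))) (catalanTree-ballot (suc m) X) ⟩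
    n C m + n C suc m               ≡⟨ nCk+nC[k+1]≡[n+1]C[k+1] n m ⟩
    suc n C suc m                   ≡⟨ cong (_C suc m) (+-suc (2 * suc m) X) ⟨
    (2 * suc m + suc X) C suc m     ∎
    where
    open ≡-Reasoning
    open +-*-Solver
    n = 2 * suc m + X
    H = catalanTree (suc m) X
    K = catalanTree m (suc (suc X))
    n≡ : 2 * m + suc (suc X) ≡ n
    n≡ = solve 2 (λ m x → con 2 :* m :+ (con 2 :+ x) := con 2 :* (con 1 :+ m) :+ x) refl m X

  -- `Cat` is a truncating quotient, so (m+1) times the tree count is first shown to be C(2m,m)
  -- exactly. It follows from the ballot difference C(2m,m) - C(2m,m-1) by absorption.
  catalanTree-Cat : ∀ m → catalanTree m 0 ≡ Cat m
  catalanTree-Cat m = sym (trans (cong (_/ suc m) (trans (sym (central m)) (*-comm (suc m) _))) (m*n/n≡m (catalanTree m 0) (suc m)))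
    where
    open ≡-Reasoning
    open +-*-Solver
    central : ∀ m → suc m * catalanTree m 0 ≡ (2 * m) C m
    central zero    = refl
    central (suc k) = +-cancelʳ-≡ (suc (suc k) * c) _ _ (begin
      suc (suc k) * h + suc (suc k) * c  ≡⟨ *-distribˡ-+ (suc (suc k)) h c ⟨
      suc (suc k) * (h + c)              ≡⟨ cong (suc (suc k) *_) ballot ⟩
      suc (suc k) * d                    ≡⟨⟩
      d + suc k * d                      ≡⟨ cong (d +_) absorb ⟩
      d + suc (suc k) * c                ∎)
      where
      n = 2 * suc k
      h = catalanTree (suc k) 0
      c = n C k
      d = n C suc k
      ballot : h + c ≡ d
      ballot = subst (λ n → h + n C k ≡ n C suc k) (+-identityʳ n) (catalanTree-ballot (suc k) 0)
      absorb : suc k * d ≡ suc (suc k) * c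
      absorb = +-cancelʳ-≡ (k * c) _ _ (trans (k*nCk n k)
        (solve 2 (λ k c → con 2 :* (con 1 :+ k) :* c := (con 2 :+ k) :* c :+ k :* c) refl k c))

  count-213-Cat : ∀ n → count (avoiders p213) (perms n) ≡ Cat n
  count-213-Cat n = trans (count-213 n) (catalanTree-Cat n)

  -- Components

  take-++-≤ : ∀ {j} (u v : List ℕ) → j ≤ length u → take j (u ++ v) ≡ take j u
  take-++-≤ {zero}  u       v _         = refl
  take-++-≤ {suc j} (x ∷ u) v (s≤s j≤u) = cong (x ∷_) (take-++-≤ u v j≤u)

  Initial : List ℕ → ℕ → Set
  Initial w i = IsPerm i (take i w)

  prefixIsInitialᵇ⇒Initial : ∀ w i → T (prefixIsInitialᵇ w i) → Initial w i
  prefixIsInitialᵇ⇒Initial w i h = ↭-of-⊇ (unique-oneTo i)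
    (λ j∈ → ∈ᵇ⇒∈ (take i w) (All.lookup (Allₚ.all⁺ _ (oneTo i) (proj₁ (to T-∧ h))) j∈))
    (≤-trans (≤-reflexive (length-take i w)) (≤-trans (m⊓n≤m i (length w)) (≤-reflexive (sym (length-oneTo i)))))

  Initial⇒prefixIsInitialᵇ : ∀ w i → Initial w i → T (prefixIsInitialᵇ w i)
  Initial⇒prefixIsInitialᵇ w i p = from T-∧
    ( Allₚ.all⁻ _ (All.tabulate (λ j∈ → ∈⇒∈ᵇ (∈-resp-↭ (↭-sym p) j∈)))
    , Allₚ.all⁻ _ (All.tabulate (λ v∈ → ∈⇒∈ᵇ (∈-resp-↭ p v∈))))

  firstᵇ-here : ∀ p x xs → T (p x) → firstᵇ p (x ∷ xs) ≡ x
  firstᵇ-here p x xs h with p x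
  ... | true = refl

  firstᵇ-++ˡ : ∀ p xs ys → Any (T ∘ p) xs → firstᵇ p (xs ++ ys) ≡ firstᵇ p xs
  firstᵇ-++ˡ p (x ∷ xs) ys h with p x in eq
  ... | true = refl
  ... | false with h
  ...   | here q  = ⊥-elim (subst T eq q)
  ...   | there q = firstᵇ-++ˡ p xs ys q

  firstᵇ-++ʳ : ∀ p xs ys → All (¬_ ∘ T ∘ p) xs → firstᵇ p (xs ++ ys) ≡ firstᵇ p ys
  firstᵇ-++ʳ p []       ys _        = refl
  firstᵇ-++ʳ p (x ∷ xs) ys (h ∷ hs) with p x
  ... | true  = contradiction tt h
  ... | false = firstᵇ-++ʳ p xs ys hs

  IsFirst : (ℕ → Set) → ℕ → Set
  IsFirst P r = 1 ≤ r × P r × (∀ {j} → 1 ≤ j → j < r → ¬ P j)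

  firstᵇ-oneTo : ∀ p n {r} → r ≤ n → IsFirst (T ∘ p) r → firstᵇ p (oneTo n) ≡ r
  firstᵇ-oneTo p zero z≤n (() , _)
  firstᵇ-oneTo p (suc n) {r} r≤ isF@(1≤r , pr , before) with r ≟ suc n
  ... | yes refl = trans (firstᵇ-++ʳ p (oneTo n) _ (All.tabulate λ j∈ → let 1≤j , j≤n = ∈-oneTo⁻ n j∈ in before 1≤j (s≤s j≤n)))
                         (firstᵇ-here p (suc n) [] pr)
  ... | no r≢ = trans (firstᵇ-++ˡ p (oneTo n) _ (lose (∈-oneTo⁺ 1≤r r≤n) pr)) (firstᵇ-oneTo p n r≤n isF)
    where r≤n = s≤s⁻¹ (≤∧≢⇒< r≤ r≢)

  first-exists : ∀ (p : ℕ → Bool) n → 1 ≤ n → T (p n) → ∃[ r ] r ≤ n × IsFirst (T ∘ p) r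
  first-exists p n 1≤n pn with search n
    where
    search : ∀ n → (∃[ r ] r ≤ n × IsFirst (T ∘ p) r) ⊎ (∀ {j} → 1 ≤ j → j ≤ n → ¬ T (p j))
    search zero    = inj₂ λ { (s≤s _) () }
    search (suc n) with search n
    ... | inj₁ (r , r≤n , f) = inj₁ (r , m≤n⇒m≤1+n r≤n , f)
    ... | inj₂ none with T? (p (suc n))
    ...   | yes q = inj₁ (suc n , ≤-refl , s≤s z≤n , q , λ 1≤j j< → none 1≤j (s≤s⁻¹ j<))
    ...   | no ¬q = inj₂ λ {j} 1≤j j≤ → [ (λ j< → none 1≤j (s≤s⁻¹ j<)) , (λ { refl → ¬q }) ]′ (m≤n⇒m<n∨m≡n j≤)
  ... | inj₁ found = found
  ... | inj₂ none  = contradiction pn (none 1≤n ≤-refl)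

  iπ-unique : ∀ w {r} → r ≤ length w → IsFirst (Initial w) r → iπ w ≡ r
  iπ-unique w r≤ (1≤r , init , before) = firstᵇ-oneTo (prefixIsInitialᵇ w) (length w) r≤
    (1≤r , Initial⇒prefixIsInitialᵇ w _ init , λ 1≤j j< → before 1≤j j< ∘ prefixIsInitialᵇ⇒Initial w _)

  iπ-spec : ∀ {n} w → 1 ≤ n → IsPerm n w → iπ w ≤ n × IsFirst (Initial w) (iπ w)
  iπ-spec {n} w 1≤n perm
    with r , r≤n , 1≤r , pr , before ← first-exists (prefixIsInitialᵇ w) n 1≤n
           (Initial⇒prefixIsInitialᵇ w n (subst (IsPerm n) (sym (take-all n w (≤-reflexive (length-IsPerm perm)))) perm))
    = subst (λ i → i ≤ n × IsFirst (Initial w) i) (sym (iπ-unique w (≤-trans r≤n (≤-reflexive (sym (length-IsPerm perm)))) isF)) (r≤n , isF)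
    where isF = 1≤r , prefixIsInitialᵇ⇒Initial w r pr , λ {j} 1≤j j< → before 1≤j j< ∘ Initial⇒prefixIsInitialᵇ w j

  indecᵇ⇒iπ : ∀ {n} w → IsPerm n w → T (indecᵇ w) → iπ w ≡ n
  indecᵇ⇒iπ w@(_ ∷ _) perm h = trans (≡ᵇ⇒≡ _ _ h) (length-IsPerm perm)

  iπ⇒indecᵇ : ∀ {n} w → 1 ≤ n → IsPerm n w → iπ w ≡ n → T (indecᵇ w)
  iπ⇒indecᵇ []        1≤n perm eq = contradiction (length-IsPerm perm) (<⇒≢ 1≤n)
  iπ⇒indecᵇ w@(_ ∷ _) 1≤n perm eq = ≡⇒≡ᵇ _ _ (trans eq (sym (length-IsPerm perm)))

  -- A shorter initial prefix of the component would also be one of w.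
  first-component-indec : ∀ {n} w → 1 ≤ n → IsPerm n w → T (indecᵇ (take (iπ w) w))
  first-component-indec {n} w 1≤n perm with r≤n , 1≤r , init , before ← iπ-spec w 1≤n perm =
    iπ⇒indecᵇ (take r w) 1≤r init (iπ-unique (take r w) (≤-reflexive (sym (length-IsPerm init)))
      (1≤r , subst (IsPerm r) (sym (trans (take-take r r w) (cong (λ i → take i w) (⊓-idem r)))) init
           , λ {j} 1≤j j<r q → before 1≤j j<r (subst (IsPerm j) (trans (take-take j r w) (cong (λ i → take i w) (m≤n⇒m⊓n≡m (<⇒≤ j<r)))) q)))
    where r = iπ w

  -- Up to length r the prefixes of `α ++ β` are those of α.
  iπ-++ : ∀ {r} α β → 1 ≤ r → IsPerm r α → T (indecᵇ α) → iπ (α ++ β) ≡ r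
  iπ-++ {r} α β 1≤r perm ind with eq ← indecᵇ⇒iπ α perm ind with _ , isF ← iπ-spec α 1≤r perm
    with _ , init , before ← subst (IsFirst (Initial α)) eq isF =
    iπ-unique (α ++ β) r≤ (1≤r , subst (IsPerm r) (sym (take-++-≤ α β r≤α)) init
      , λ {j} 1≤j j<r q → before 1≤j j<r (subst (IsPerm j) (take-++-≤ α β (≤-trans (<⇒≤ j<r) r≤α)) q))
    where
    r≤α = ≤-reflexive (sym (length-IsPerm perm))
    r≤ : r ≤ length (α ++ β)
    r≤ = ≤-trans r≤α (≤-trans (m≤m+n _ _) (≤-reflexive (sym (length-++ α))))

  -- A leading 1 would make the prefix of length 1 initial, so the first letter differs from 1 and
  -- forms a 21 with the 1 that comes later.
  indec-contains-21 : ∀ {r} α → 2 ≤ r → IsPerm r α → T (indecᵇ α) → Contains (2 ∷ 1 ∷ []) α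
  indec-contains-21 {r} [] 2≤r perm ind = contradiction (length-IsPerm perm) (<⇒≢ (<-trans (s≤s z≤n) 2≤r))
  indec-contains-21 {r} (a ∷ α) 2≤r perm ind with a ≟ 1
  ... | yes refl = contradiction (prep 1 ↭-refl) (before ≤-refl 2≤r)
    where
    before = proj₂ (proj₂ (subst (IsFirst (Initial (1 ∷ α))) (indecᵇ⇒iπ (1 ∷ α) perm ind) (proj₂ (iπ-spec (1 ∷ α) (<-trans ≤-refl 2≤r) perm))))
  ... | no a≢1 with ∈-resp-↭ (↭-sym perm) (∈-oneTo⁺ {1} {r} ≤-refl (<⇒≤ 2≤r))
  ...   | here 1≡a   = contradiction (sym 1≡a) a≢1
  ...   | there 1∈α  = Contains-21⁺ (refl ∷ Sub.from∈ 1∈α)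
          (≤∧≢⇒< (proj₁ (All.lookup (letters-IsPerm {r} perm) (here refl))) (λ eq → a≢1 (sym eq)))

  -- Permutations starting with 1

  one⊕ : List ℕ → List ℕ
  one⊕ w = 1 ∷ map suc w

  oneTo-suc : ∀ n → oneTo (suc n) ≡ one⊕ (oneTo n)
  oneTo-suc zero    = refl
  oneTo-suc (suc n) = trans (cong (_∷ʳ suc (suc n)) (oneTo-suc n)) (cong (1 ∷_) (sym (map-++ suc (oneTo n) [ suc n ])))

  one⊕-IsPerm : ∀ {n w} → IsPerm n w → IsPerm (suc n) (one⊕ w)
  one⊕-IsPerm {n} perm = ↭-trans (prep 1 (Perm.map⁺ suc perm)) (↭-reflexive (sym (oneTo-suc n)))

  one⊕-IsPerm⁻ : ∀ {n β} → IsPerm (suc n) (1 ∷ β) → ∃[ w ] β ≡ map suc w × IsPerm n w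
  one⊕-IsPerm⁻ {n} perm with w , eq , p ← Perm.↭-map-inv suc (↭-sym (drop-∷ (↭-trans perm (↭-reflexive (oneTo-suc n))))) =
    w , eq , ↭-sym p

  iπ-one⊕ : ∀ {n} w → IsPerm n w → iπ (one⊕ w) ≡ 1
  iπ-one⊕ w perm = iπ-unique (one⊕ w) (s≤s z≤n) (≤-refl , ↭-refl , λ { (s≤s _) (s≤s ()) })

  iπ≡1⇒one⊕ : ∀ {n} w → IsPerm (suc n) w → iπ w ≡ 1 → ∃[ v ] w ≡ one⊕ v × IsPerm n v
  iπ≡1⇒one⊕ w perm eq with _ , _ , init , _ ← subst (λ i → i ≤ _ × IsFirst (Initial w) i) eq (iπ-spec w (s≤s z≤n) perm)
    with w | Perm.↭-singleton-inv init
  ... | .1 ∷ β | refl with v , refl , p ← one⊕-IsPerm⁻ perm = v , refl , p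

  all-zip-suc : ∀ (f g : ℕ × ℕ → Bool) → (∀ a b → f (suc a , b) ≡ g (a , b)) →
    ∀ as bs → all f (zip (map suc as) bs) ≡ all g (zip as bs)
  all-zip-suc f g h []       bs       = refl
  all-zip-suc f g h (a ∷ as) []       = refl
  all-zip-suc f g h (a ∷ as) (b ∷ bs) = cong₂ _∧_ (h a b) (all-zip-suc f g h as bs)

  orderIsoᵇ-suc : ∀ s τ → orderIsoᵇ (map suc s) τ ≡ orderIsoᵇ s τ
  orderIsoᵇ-suc []      []      = refl
  orderIsoᵇ-suc []      (_ ∷ _) = refl
  orderIsoᵇ-suc (_ ∷ _) []      = refl
  orderIsoᵇ-suc (a ∷ s) (b ∷ τ) = cong₂ _∧_ (all-zip-suc _ _ (λ _ _ → refl) s τ) (orderIsoᵇ-suc s τ)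

  OrderIso-suc : ∀ s τ → OrderIso τ (map suc s) ≡ OrderIso τ s
  OrderIso-suc s τ = cong₂ (λ l b → T ((l ≡ᵇ length τ) ∧ b)) (length-map suc s) (orderIsoᵇ-suc s τ)

  ⊆-map⁻ : ∀ {s} w → s ⊆ map suc w → ∃[ s′ ] s ≡ map suc s′ × s′ ⊆ w
  ⊆-map⁻ []      []         = [] , refl , []
  ⊆-map⁻ (x ∷ w) (skip _ p) with s′ , eq , q ← ⊆-map⁻ w p = s′ , eq , skip x q
  ⊆-map⁻ (x ∷ w) (refl ∷ p) with s′ , refl , q ← ⊆-map⁻ w p = x ∷ s′ , refl , refl ∷ q

  Contains-one⊕⁺ : ∀ {τ w} → Contains τ w → Contains τ (one⊕ w)
  Contains-one⊕⁺ {τ} (s , s⊆w , iso) = map suc s , skip 1 (Subₚ.map⁺ suc s⊆w) , subst id (sym (OrderIso-suc s τ)) iso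

  -- The leading 1 cannot play the 2 of the pattern, because no later letter is smaller; the whole
  -- occurrence lies in the shifted part.
  Contains-one⊕⁻ : ∀ {τ w} → Contains (2 ∷ 1 ∷ τ) (one⊕ w) → Contains (2 ∷ 1 ∷ τ) w
  Contains-one⊕⁻ {τ} {w} (s , skip _ p , iso) with s′ , refl , q ← ⊆-map⁻ w p = s′ , q , subst id (OrderIso-suc s′ (2 ∷ 1 ∷ τ)) iso
  Contains-one⊕⁻ {τ} {w} (_ ∷ s , refl ∷ p , iso) with ⊆-map⁻ w p
  ... | []     , refl , _ = ⊥-elim iso
  -- The test whether `suc b` is below 1 computes to false, against true in the pattern. The
  -- opposite test still depends on b, hence the case split in `no-descent`.
  ... | b ∷ s′ , refl , _ = ⊥-elim (no-descent (0 <ᵇ b) (proj₁ (to T-∧ (proj₂ (to (T-∧ {length (one⊕ (b ∷ s′)) ≡ᵇ length (2 ∷ 1 ∷ τ)}) iso)))))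
    where
    no-descent : ∀ c {d} → T (((c ==ᵇ false) ∧ false) ∧ d) → ⊥
    no-descent true  ()
    no-descent false ()

  des-map-suc : ∀ w → des (map suc w) ≡ des w
  des-map-suc []          = refl
  des-map-suc (a ∷ [])    = refl
  des-map-suc (a ∷ b ∷ w) = cong ((if b <ᵇ a then 1 else 0) +_) (des-map-suc (b ∷ w))

  des-one⊕ : ∀ w → des (one⊕ w) ≡ des w
  des-one⊕ []      = refl
  des-one⊕ (a ∷ w) = des-map-suc (a ∷ w)

  -- Permutations ending with a decreasing run of their largest letters

  decreasing : ℕ → ℕ → List ℕ
  decreasing r zero    = []
  decreasing r (suc a) = suc a + r ∷ decreasing r a

  oneTo-+ : ∀ r a → oneTo (a + r) ↭ oneTo r ++ decreasing r a
  oneTo-+ r zero    = ↭-reflexive (sym (++-identityʳ (oneTo r)))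
  oneTo-+ r (suc a) = ↭-trans (↭-sym (Perm.∷↭∷ʳ (suc a + r) (oneTo (a + r))))
    (↭-trans (prep _ (oneTo-+ r a)) (↭-sym (shift (suc a + r) (oneTo r) (decreasing r a))))

  ↭-cancelˡ : ∀ (u : List ℕ) {v w} → u ++ v ↭ u ++ w → v ↭ w
  ↭-cancelˡ []      p = p
  ↭-cancelˡ (x ∷ u) p = ↭-cancelˡ u (drop-∷ p)

  decreasing-letters : ∀ r a → All (λ d → r < d × d ≤ a + r) (decreasing r a)
  decreasing-letters r zero    = []
  decreasing-letters r (suc a) = (s≤s (m≤n+m r a) , ≤-refl) ∷ All.map (map₂ m≤n⇒m≤1+n) (decreasing-letters r a)

  decreasing-sorted : ∀ r a → AllPairs (λ x y → y ≤ x) (decreasing r a)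
  decreasing-sorted r zero    = []
  decreasing-sorted r (suc a) = All.map (λ (_ , d≤) → m≤n⇒m≤1+n d≤) (decreasing-letters r a) ∷ decreasing-sorted r a

  ≤-head : ∀ {x y w} → All (_≤ y) w → x ∈ y ∷ w → x ≤ y
  ≤-head y≥ (here refl) = ≤-refl
  ≤-head y≥ (there x∈)  = All.lookup y≥ x∈

  sorted-↭⇒≡ : ∀ {v w} → AllPairs (λ x y → y ≤ x) v → AllPairs (λ x y → y ≤ x) w → v ↭ w → v ≡ w
  sorted-↭⇒≡ {[]}    {w}     _ _ p = sym (Perm.↭-empty-inv (↭-sym p))
  sorted-↭⇒≡ {x ∷ v} {[]}    _ _ p = contradiction p Perm.¬x∷xs↭[]
  sorted-↭⇒≡ {x ∷ v} {y ∷ w} (x≥ ∷ sv) (y≥ ∷ sw) p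
    with refl ← ≤-antisym (≤-head y≥ (∈-resp-↭ p (here refl))) (≤-head x≥ (∈-resp-↭ (↭-sym p) (here refl))) =
    cong (x ∷_) (sorted-↭⇒≡ sv sw (drop-∷ p))

  sorted-of-pairs : ∀ w → (∀ {c d} → c ∷ d ∷ [] ⊆ w → d ≤ c) → AllPairs (λ x y → y ≤ x) w
  sorted-of-pairs []      h = []
  sorted-of-pairs (x ∷ w) h = All.tabulate (λ d∈ → h (refl ∷ Sub.from∈ d∈)) ∷ sorted-of-pairs w (h ∘ skip x)

  sorted-pair : ∀ {w c d} → AllPairs (λ x y → y ≤ x) w → c ∷ d ∷ [] ⊆ w → d ≤ c
  sorted-pair (_ ∷ sw)  (skip _ p) = sorted-pair sw p
  sorted-pair (x≥ ∷ _)  (refl ∷ p) = All.lookup x≥ (Sub.lookup p (here refl))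

  ++decreasing-IsPerm : ∀ {r a α} → IsPerm r α → IsPerm (a + r) (α ++ decreasing r a)
  ++decreasing-IsPerm {r} {a} perm = ↭-trans (Perm.++⁺ʳ (decreasing r a) perm) (↭-sym (oneTo-+ r a))

  213<4 : All (_< 4) p213
  213<4 = s≤s (s≤s (s≤s z≤n)) ∷ s≤s (s≤s z≤n) ∷ ≤-refl ∷ []

  21<3 : All (_< 3) (2 ∷ 1 ∷ [])
  21<3 = ≤-refl ∷ s≤s (s≤s z≤n) ∷ []

  -- The last letter of a 2134 is its maximum. With two letters in β it would exceed an earlier
  -- letter of β, against the order there; so the first three letters lie in α and form a 213.
  avoids-2134-++-sorted : ∀ α {β} → AllPairs (λ x y → y ≤ x) β → Avoids p213 α → Avoids p2134 (α ++ β)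
  avoids-2134-++-sorted α sβ av (s , s⊆ , iso)
    with s′ , d , refl , iso′ , s′<d ← OrderIso-∷ʳ⁻ p213 4 213<4 s iso with ⊆-++⁻ α s⊆
  ... | s₁ , s₂ , eq , p₁ , p₂ with initLast s₂
  ...   | [] = av (s′ , ⊆-trans (Subₚ.++⁺ʳ [ d ] ⊆-refl) (⊆-trans (⊆-reflexive (trans eq (++-identityʳ s₁))) p₁) , iso′)
  ...   | [] ∷ʳ′ e with refl , refl ← ∷ʳ-injective s′ s₁ eq = av (s′ , p₁ , iso′)
  ...   | (c ∷ t) ∷ʳ′ e with refl , refl ← ∷ʳ-injective s′ (s₁ ++ c ∷ t) (trans eq (sym (++-assoc s₁ (c ∷ t) [ e ]))) =
    <⇒≱ (All.lookup s′<d (∈-++⁺ʳ s₁ (here refl))) (sorted-pair sβ (⊆-trans (refl ∷ Sub.from∈ (∈-++⁺ʳ t (here refl))) p₂))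

  -- A 21 in the first component and an ascent in the remainder would form a 2134.
  remainder-sorted : ∀ {r} α β → All (_≤ r) α → All (r <_) β → Contains (2 ∷ 1 ∷ []) α → Avoids p2134 (α ++ β) →
    AllPairs (λ x y → y ≤ x) β
  remainder-sorted {r} α β α≤r r<β (s , s⊆α , iso) av = sorted-of-pairs β λ {c} {d} p → ≮⇒≥ λ c<d →
    let r<c = All.lookup r<β (Sub.lookup p (here refl))
        s<c = All.map (λ x≤r → ≤-<-trans x≤r r<c) (Subₚ.All-resp-⊆ s⊆α α≤r)
    in av ( (s ∷ʳ c) ∷ʳ d
          , ⊆-trans (⊆-reflexive (++-assoc s [ c ] [ d ])) (Subₚ.++⁺ s⊆α p)
          , OrderIso-∷ʳ⁺ p213 4 213<4 (s ∷ʳ c) d (OrderIso-∷ʳ⁺ (2 ∷ 1 ∷ []) 3 21<3 s c iso s<c)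
              (Allₚ.++⁺ (All.map (λ x<c → <-trans x<c c<d) s<c) (c<d ∷ [])))

  drop-nonempty : ∀ r (w : List ℕ) → r < length w → ∃₂ λ b β → drop r w ≡ b ∷ β
  drop-nonempty zero    (b ∷ β) _         = b , β , refl
  drop-nonempty (suc r) (x ∷ w) (s≤s r<l) = drop-nonempty r w r<l

  remainder-↭ : ∀ {a r} w → IsPerm (a + r) w → Initial w r → drop r w ↭ decreasing r a
  remainder-↭ {a} {r} w perm init = ↭-cancelˡ (take r w) (↭-trans (↭-reflexive (take++drop≡id r w))
    (↭-trans perm (↭-trans (oneTo-+ r a) (Perm.++⁺ʳ (decreasing r a) (↭-sym init)))))

  remainder-letters : ∀ {a r} w → IsPerm (a + r) w → Initial w r → All (r <_) (drop r w)
  remainder-letters {a} {r} w perm init =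
    All-resp-↭ (↭-sym (remainder-↭ {a} w perm init)) (All.map proj₁ (decreasing-letters r a))

  -- A proper initial prefix is followed by at least one letter, and that letter is larger than the
  -- whole prefix, so it tops the occurrence.
  component-contains-⊕1 : ∀ {n r} τ μ → All (_< μ) τ → ∀ w → IsPerm n w → r < n → Initial w r →
    Contains τ (take r w) → Contains (τ ∷ʳ μ) w
  component-contains-⊕1 {n} {r} τ μ τ<μ w perm r<n init c
    with b , β , eq ← drop-nonempty r w (subst (r <_) (sym (length-IsPerm perm)) r<n)
    = subst (Contains (τ ∷ʳ μ)) (trans (cong (take r w ++_) (sym eq)) (take++drop≡id r w))
        (Contains-top⁺ τ μ τ<μ (take r w) (All.map (λ (_ , x≤r) → ≤-<-trans x≤r r<b) (letters-IsPerm init)) c)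
    where
    n≡ : n ∸ r + r ≡ n
    n≡ = m∸n+n≡m (<⇒≤ r<n)
    r<b : r < b
    r<b = All.lookup (remainder-letters {n ∸ r} w (subst (λ k → IsPerm k w) (sym n≡) perm) init) (subst (b ∈_) (sym eq) (here refl))

  -- The junction is an ascent, as all letters of α are at most r < b.
  des-++ : ∀ {r} α b β → 1 ≤ length α → All (_≤ r) α → r < b → des (α ++ b ∷ β) ≡ des α + des (b ∷ β)
  des-++ (x ∷ [])     b β _ (x≤r ∷ [])  r<b rewrite <ᵇ-false (<⇒≤ (≤-<-trans x≤r r<b)) = refl
  des-++ (x ∷ y ∷ α) b β _ (_ ∷ y≤r) r<b =
    trans (cong ((if y <ᵇ x then 1 else 0) +_) (des-++ (y ∷ α) b β (s≤s z≤n) y≤r r<b))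
          (sym (+-assoc (if y <ᵇ x then 1 else 0) (des (y ∷ α)) (des (b ∷ β))))

  des-decreasing : ∀ r a → des (decreasing r (suc a)) ≡ a
  des-decreasing r zero    = refl
  des-decreasing r (suc a) rewrite <ᵇ-true (n<1+n (a + r)) = cong suc (des-decreasing r a)

  -- A run of a + 1 letters adds a descents, one power of q fewer than of x; hence the factor x / (1
  -- - xq).
  des-++-decreasing : ∀ {r} α a → 1 ≤ r → IsPerm r α → des (α ++ decreasing r (suc a)) ≡ des α + a
  des-++-decreasing {r} α a 1≤r perm = trans
    (des-++ α (suc a + r) (decreasing r a) (subst (1 ≤_) (sym (length-IsPerm perm)) 1≤r) (All.map proj₂ (letters-IsPerm perm)) (s≤s (m≤n+m r a)))
    (cong (des α +_) (des-decreasing r a))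

  -- Decomposable avoiders of 213 and 2134

  decomposableAvoiders indecomposableAvoiders : List ℕ → ℕ → List (List ℕ)
  decomposableAvoiders   τ n = filterᵇ (λ w → avoidsᵇ w τ ∧ not (indecᵇ w)) (perms n)
  indecomposableAvoiders τ n = filterᵇ (λ w → avoidsᵇ w τ ∧ indecᵇ w) (perms n)

  ∈-avoiders : ∀ {τ n w} → w ∈ filterᵇ (avoiders τ) (perms n) ⇔ (IsPerm n w × Avoids τ w)
  ∈-avoiders {τ} {n} {w} = mk⇔
    (λ w∈ → let w∈perms , h = ∈-filter⁻ (T? ∘ avoiders τ) {xs = perms n} w∈ in ∈-perms⁻ n w∈perms , avoidsᵇ⇒Avoids τ w h)
    (λ (perm , av) → ∈-filter⁺ (T? ∘ avoiders τ) (∈-perms⁺ n perm) (Avoids⇒avoidsᵇ τ w av))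

  ∈-indecomposableAvoiders : ∀ {τ n w} → w ∈ indecomposableAvoiders τ n ⇔ (IsPerm n w × Avoids τ w × T (indecᵇ w))
  ∈-indecomposableAvoiders {τ} {n} {w} = mk⇔
    (λ w∈ → let w∈perms , h = ∈-filter⁻ (T? ∘ q) {xs = perms n} w∈; h₁ , h₂ = to (T-∧ {avoidsᵇ w τ}) h
            in ∈-perms⁻ n w∈perms , avoidsᵇ⇒Avoids τ w h₁ , h₂)
    (λ (perm , av , ind) → ∈-filter⁺ (T? ∘ q) (∈-perms⁺ n perm) (from T-∧ (Avoids⇒avoidsᵇ τ w av , ind)))
    where q = λ w → avoidsᵇ w τ ∧ indecᵇ w

  ∈-decomposableAvoiders : ∀ {τ n w} → 1 ≤ n → w ∈ decomposableAvoiders τ n ⇔ (IsPerm n w × Avoids τ w × iπ w < n)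
  ∈-decomposableAvoiders {τ} {n} {w} 1≤n = mk⇔
    (λ w∈ → let w∈perms , h = ∈-filter⁻ (T? ∘ q) {xs = perms n} w∈; h₁ , h₂ = to (T-∧ {avoidsᵇ w τ}) h; perm = ∈-perms⁻ n w∈perms
            in perm , avoidsᵇ⇒Avoids τ w h₁ , ≤∧≢⇒< (proj₁ (iπ-spec w 1≤n perm)) (T-not⇒¬T h₂ ∘ iπ⇒indecᵇ w 1≤n perm))
    (λ (perm , av , i<n) → ∈-filter⁺ (T? ∘ q) (∈-perms⁺ n perm)
       (from T-∧ (Avoids⇒avoidsᵇ τ w av , ¬T⇒T-not (<⇒≢ i<n ∘ indecᵇ⇒iπ w perm))))
    where q = λ w → avoidsᵇ w τ ∧ not (indecᵇ w)

  one⊕-decomposable : ∀ {τ n v} → 1 ≤ n → v ∈ map one⊕ (filterᵇ (avoiders (2 ∷ 1 ∷ τ)) (perms n)) →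
    v ∈ decomposableAvoiders (2 ∷ 1 ∷ τ) (suc n)
  one⊕-decomposable {τ} {n} 1≤n v∈ with w , w∈ , refl ← ∈-map⁻ one⊕ v∈ with perm , av ← to (∈-avoiders {n = n}) w∈ =
    from (∈-decomposableAvoiders (s≤s z≤n))
      (one⊕-IsPerm perm , av ∘ Contains-one⊕⁻ , subst (_< suc n) (sym (iπ-one⊕ {n} w perm)) (s≤s 1≤n))

  decomposable-one⊕ : ∀ {τ n w} → IsPerm (suc n) w → Avoids τ w → iπ w ≡ 1 →
    w ∈ map one⊕ (filterᵇ (avoiders τ) (perms n))
  decomposable-one⊕ {τ} {n} {w} perm av eq =
    let v , w≡ , p = iπ≡1⇒one⊕ {n} w perm eq
    in subst (_∈ map one⊕ (filterᵇ (avoiders τ) (perms n))) (sym w≡)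
         (∈-map⁺ one⊕ (from (∈-avoiders {τ} {n} {v}) (p , av ∘ subst (Contains τ) (sym w≡) ∘ Contains-one⊕⁺)))

  unique-one⊕ : ∀ τ n → Unique (map one⊕ (filterᵇ (avoiders τ) (perms n)))
  unique-one⊕ τ n = Uniqueₚ.map⁺ (map-injective suc-injective ∘ ∷-injectiveʳ)
    (Uniqueₚ.filter⁺ (T? ∘ avoiders τ) (unique-perms n))

  first-component-contains-21 : ∀ {n} w → 1 ≤ n → IsPerm n w → iπ w ≢ 1 → Contains (2 ∷ 1 ∷ []) (take (iπ w) w)
  first-component-contains-21 {n} w 1≤n perm i≢1 with _ , 1≤i , init , _ ← iπ-spec {n} w 1≤n perm =
    indec-contains-21 (take (iπ w) w) (≤∧≢⇒< 1≤i (i≢1 ∘ sym)) init (first-component-indec {n} w 1≤n perm)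

  -- A first component other than 1 contains 21, and any letter of the remainder completes it to
  -- 213.
  decomposable-213 : ∀ n → 1 ≤ n →
    decomposableAvoiders p213 (suc n) ↭ map one⊕ (filterᵇ (avoiders p213) (perms n))
  decomposable-213 n 1≤n = ↭-of-unique (Uniqueₚ.filter⁺ _ (unique-perms (suc n))) (unique-one⊕ p213 n)
    (mk⇔ forth (one⊕-decomposable {3 ∷ []} {n} 1≤n))
    where
    forth : ∀ {w} → w ∈ decomposableAvoiders p213 (suc n) → w ∈ map one⊕ (filterᵇ (avoiders p213) (perms n))
    forth {w} w∈ = by-component (to (∈-decomposableAvoiders (s≤s z≤n)) w∈) (iπ w ≟ 1)
      where
      by-component : IsPerm (suc n) w × Avoids p213 w × iπ w < suc n → Dec (iπ w ≡ 1) →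
        w ∈ map one⊕ (filterᵇ (avoiders p213) (perms n))
      by-component (perm , av , i<n) (yes eq) = decomposable-one⊕ {n = n} perm av eq
      by-component (perm , av , i<n) (no ne)  = contradiction (component-contains-⊕1 (2 ∷ 1 ∷ []) 3 21<3 w perm i<n
        (proj₁ (proj₂ (proj₂ (iπ-spec {suc n} w (s≤s z≤n) perm)))) (first-component-contains-21 {suc n} w (s≤s z≤n) perm ne)) av

  -- The permutations α ⊕ δ of [n] with δ of length a.
  runExtensions : ℕ → ℕ → List (List ℕ)
  runExtensions n a = map (_++ decreasing (n ∸ a) a) (indecomposableAvoiders p213 (n ∸ a))

  iπ-runExtensions : ∀ {n a w} → a < n → w ∈ runExtensions n a → iπ w ≡ n ∸ a
  iπ-runExtensions {n} {a} a<n w∈ with α , α∈ , refl ← ∈-map⁻ (_++ decreasing (n ∸ a) a) w∈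
    with perm , _ , ind ← to (∈-indecomposableAvoiders {n = n ∸ a}) α∈ =
    iπ-++ α (decreasing (n ∸ a) a) (m<n⇒0<n∸m a<n) perm ind

  module _ (m : ℕ) where
    private
      n : ℕ
      n = suc (suc m)

      a<n : ∀ {a} → a ∈ oneTo m → suc a < n
      a<n a∈ = s≤s (s≤s (proj₂ (∈-oneTo⁻ m a∈)))

    -- The run length a stops at m = n - 2, which leaves at least two letters to α. Hence `iπ`
    -- separates all the pieces: it is 1 on 1 ⊕ β and n - a, at least 2, on α ⊕ δ.
    decomposable-2134 : decomposableAvoiders p2134 n ↭
      map one⊕ (filterᵇ (avoiders p2134) (perms (suc m))) ++ concatMap (runExtensions n) (oneTo m)
    decomposable-2134 = ↭-of-unique (Uniqueₚ.filter⁺ _ (unique-perms n))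
      (Uniqueₚ.++⁺ (unique-one⊕ p2134 (suc m)) unique-runs disjoint) (mk⇔ forth back)
      where
      unique-runs : Unique (concatMap (runExtensions n) (oneTo m))
      unique-runs = unique-concatMap (runExtensions n) (λ w → n ∸ iπ w) id (oneTo m)
        (subst Unique (sym (map-id (oneTo m))) (unique-oneTo m))
        (λ {a} _ → Uniqueₚ.map⁺ (λ {u} {v} → ++-cancelʳ (decreasing (n ∸ a) a) u v) (Uniqueₚ.filter⁺ _ (unique-perms (n ∸ a))))
        (λ {a} a∈ w∈ → trans (cong (n ∸_) (iπ-runExtensions (<⇒≤ (a<n a∈)) w∈)) (m∸[m∸n]≡n (<⇒≤ (<⇒≤ (a<n a∈)))))
      disjoint : ∀ {w} → w ∈ map one⊕ (filterᵇ (avoiders p2134) (perms (suc m))) × w ∈ concatMap (runExtensions n) (oneTo m) → ⊥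
      disjoint (w∈ , w∈′) with v , v∈ , refl ← ∈-map⁻ one⊕ w∈
        with a , a∈ , w∈a ← find (∈-concatMap⁻ (runExtensions n) {oneTo m} w∈′) =
        <⇒≢ (m+n≤o⇒m≤o∸n 2 (a<n a∈))
          (trans (sym (iπ-one⊕ v (proj₁ (to (∈-avoiders {n = suc m}) v∈)))) (iπ-runExtensions (<⇒≤ (a<n a∈)) w∈a))
      back : ∀ {w} → w ∈ map one⊕ (filterᵇ (avoiders p2134) (perms (suc m))) ++ concatMap (runExtensions n) (oneTo m) →
        w ∈ decomposableAvoiders p2134 n
      back w∈ with ∈-++⁻ (map one⊕ (filterᵇ (avoiders p2134) (perms (suc m)))) w∈
      ... | inj₁ w∈₁ = one⊕-decomposable {3 ∷ 4 ∷ []} {suc m} (s≤s z≤n) w∈₁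
      ... | inj₂ w∈₂ with a , a∈ , w∈a ← find (∈-concatMap⁻ (runExtensions n) {oneTo m} w∈₂)
        with i≡ ← iπ-runExtensions (<⇒≤ (a<n a∈)) w∈a
        with α , α∈ , refl ← ∈-map⁻ (_++ decreasing (n ∸ a) a) w∈a
        with perm , av , ind ← to (∈-indecomposableAvoiders {n = n ∸ a}) α∈ =
        from (∈-decomposableAvoiders (s≤s z≤n))
          ( subst (λ k → IsPerm k (α ++ decreasing (n ∸ a) a)) (m+[n∸m]≡n (<⇒≤ (<⇒≤ (a<n a∈)))) (++decreasing-IsPerm {n ∸ a} {a} perm)
          , avoids-2134-++-sorted α (decreasing-sorted (n ∸ a) a) av
          , subst (_< n) (sym i≡) (∸-monoʳ-< (proj₁ (∈-oneTo⁻ m a∈)) (<⇒≤ (<⇒≤ (a<n a∈)))))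
      forth : ∀ {w} → w ∈ decomposableAvoiders p2134 n →
        w ∈ map one⊕ (filterᵇ (avoiders p2134) (perms (suc m))) ++ concatMap (runExtensions n) (oneTo m)
      forth {w} w∈ = by-component (to (∈-decomposableAvoiders (s≤s z≤n)) w∈) (iπ w ≟ 1)
        where
        by-component : IsPerm n w × Avoids p2134 w × iπ w < n → Dec (iπ w ≡ 1) →
          w ∈ map one⊕ (filterᵇ (avoiders p2134) (perms (suc m))) ++ concatMap (runExtensions n) (oneTo m)
        by-component (perm , av , i<n) (yes eq) = ∈-++⁺ˡ (decomposable-one⊕ {n = suc m} perm av eq)
        by-component (perm , av , i<n) (no ne)  = ∈-++⁺ʳ (map one⊕ (filterᵇ (avoiders p2134) (perms (suc m))))
          (∈-concatMap⁺ (runExtensions n) (lose a∈ w∈a))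
          where
          r = iπ w
          a = n ∸ r
          spec = iπ-spec {n} w (s≤s z≤n) perm
          init = proj₁ (proj₂ (proj₂ spec))
          a+r≡n : a + r ≡ n
          a+r≡n = m∸n+n≡m (<⇒≤ i<n)
          n∸a≡r : n ∸ a ≡ r
          n∸a≡r = m∸[m∸n]≡n (<⇒≤ i<n)
          2≤r : 2 ≤ r
          2≤r = ≤∧≢⇒< (proj₁ (proj₂ spec)) (ne ∘ sym)
          a∈ : a ∈ oneTo m
          a∈ = ∈-oneTo⁺ (m<n⇒0<n∸m i<n) (∸-monoʳ-≤ n 2≤r)
          perm′ : IsPerm (a + r) w
          perm′ = subst (λ k → IsPerm k w) (sym a+r≡n) perm
          tail≡ : drop r w ≡ decreasing r a
          -- A decreasing word is determined by its letters, so the remainder can only be the run.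
          tail≡ = sorted-↭⇒≡
            (remainder-sorted (take r w) (drop r w) (All.map proj₂ (letters-IsPerm {r} init)) (remainder-letters {a} w perm′ init)
              (first-component-contains-21 {n} w (s≤s z≤n) perm ne) (subst (Avoids p2134) (sym (take++drop≡id r w)) av))
            (decreasing-sorted r a) (remainder-↭ {a} w perm′ init)
          w∈a : w ∈ runExtensions n a
          w∈a = subst (λ k → w ∈ map (_++ decreasing k a) (indecomposableAvoiders p213 k)) (sym n∸a≡r)
            (subst (_∈ map (_++ decreasing r a) (indecomposableAvoiders p213 r))
              (trans (cong (take r w ++_) (sym tail≡)) (take++drop≡id r w))
              (∈-map⁺ (_++ decreasing r a) (from (∈-indecomposableAvoiders {n = r})
                -- A 213 in the first component would be topped to a 2134 by a letter of the
                -- remainder.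
                ( init , av ∘ component-contains-⊕1 p213 4 213<4 w perm i<n init , first-component-indec {n} w (s≤s z≤n) perm))))

  -- Counting

  count-cong : ∀ {p q} ws → (∀ {w} → w ∈ ws → p w ≡ q w) → count p ws ≡ count q ws
  count-cong         []       h = refl
  count-cong {p} {q} (w ∷ ws) h rewrite h (here refl) with q w
  ... | true  = cong suc (count-cong ws (h ∘ there))
  ... | false = count-cong ws (h ∘ there)

  count-none : ∀ {p} ws → (∀ {w} → w ∈ ws → p w ≡ false) → count p ws ≡ 0
  count-none []       h = refl
  count-none (w ∷ ws) h rewrite h (here refl) = count-none ws (h ∘ there)

  count-map : ∀ p (f : List ℕ → List ℕ) ws → count p (map f ws) ≡ count (p ∘ f) ws
  count-map p f []       = refl
  count-map p f (w ∷ ws) with p (f w)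
  ... | true  = cong suc (count-map p f ws)
  ... | false = count-map p f ws

  count-filterᵇ : ∀ (p q : List ℕ → Bool) ws → count p (filterᵇ q ws) ≡ count (λ w → q w ∧ p w) ws
  count-filterᵇ p q []       = refl
  count-filterᵇ p q (w ∷ ws) with q w
  ... | false = count-filterᵇ p q ws
  ... | true with p w
  ...   | true  = cong suc (count-filterᵇ p q ws)
  ...   | false = count-filterᵇ p q ws

  count-++ : ∀ p us vs → count p (us ++ vs) ≡ count p us + count p vs
  count-++ p us vs = trans (cong length (filter-++ (T? ∘ p) us vs)) (length-++ (filterᵇ p us))

  count-↭ : ∀ p {us vs} → us ↭ vs → count p us ≡ count p vs
  count-↭ p us↭vs = ↭-length (filter-↭ (T? ∘ p) us↭vs)

  count-concatMap : ∀ p (f : ℕ → List (List ℕ)) js → count p (concatMap f js) ≡ sum (map (count p ∘ f) js)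
  count-concatMap p f []       = refl
  count-concatMap p f (j ∷ js) = trans (count-++ p (f j) (concatMap f js)) (cong (count p (f j) +_) (count-concatMap p f js))

  length-concatMap : ∀ (f : ℕ → List (List ℕ)) js → length (concatMap f js) ≡ sum (map (length ∘ f) js)
  length-concatMap f []       = refl
  length-concatMap f (j ∷ js) = trans (length-++ (f j)) (cong (length (f j) +_) (length-concatMap f js))

  count-split : ∀ (p q r : List ℕ → Bool) ws → count (λ w → p w ∧ r w) ws ≡
    count (λ w → p w ∧ q w ∧ r w) ws + count r (filterᵇ (λ w → p w ∧ not (q w)) ws)
  count-split p q r []       = refl
  count-split p q r (w ∷ ws) with p w | q w
  ... | false | _ = count-split p q r ws
  count-split p q r (w ∷ ws) | true | true with r w
  ... | true  = cong suc (count-split p q r ws)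
  ... | false = count-split p q r ws
  count-split p q r (w ∷ ws) | true | false with r w
  ... | true  = trans (cong suc (count-split p q r ws)) (sym (+-suc _ _))
  ... | false = count-split p q r ws

  count-split-total : ∀ (p q : List ℕ → Bool) ws → count p ws ≡
    count (λ w → p w ∧ q w) ws + length (filterᵇ (λ w → p w ∧ not (q w)) ws)
  count-split-total p q []       = refl
  count-split-total p q (w ∷ ws) with p w | q w
  ... | false | _     = count-split-total p q ws
  ... | true  | true  = cong suc (count-split-total p q ws)
  ... | true  | false = trans (cong suc (count-split-total p q ws)) (sym (+-suc _ _))

  runCount : ℕ → ℕ → ℕ → ℕ
  runCount n i a = count (λ w → des w ≡ᵇ i) (runExtensions n a)

  -- The lengths start at 2: at length 1, β in 1 ⊕ β is empty and the permutation is indecomposable.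
  Acount-2134 : ∀ m i → Acount p2134 (2 + m) i ≡
    Icount p2134 (2 + m) i + (Acount p2134 (1 + m) i + sum (map (runCount (2 + m) i) (oneTo m)))
  Acount-2134 m i = begin
    Acount p2134 n i
      ≡⟨ count-split (avoiders p2134) indecᵇ d (perms n) ⟩
    Icount p2134 n i + count d (decomposableAvoiders p2134 n)
      ≡⟨ cong (Icount p2134 n i +_) (trans (count-↭ d (decomposable-2134 m)) (count-++ d ones runs)) ⟩
    Icount p2134 n i + (count d ones + count d runs)
      ≡⟨ cong₂ (λ x y → Icount p2134 n i + (x + y)) ones≡ (count-concatMap d (runExtensions n) (oneTo m)) ⟩
    Icount p2134 n i + (Acount p2134 (1 + m) i + sum (map (runCount n i) (oneTo m))) ∎
    where
    open ≡-Reasoning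
    n = 2 + m
    d = λ w → des w ≡ᵇ i
    ones = map one⊕ (filterᵇ (avoiders p2134) (perms (1 + m)))
    runs = concatMap (runExtensions n) (oneTo m)
    ones≡ : count d ones ≡ Acount p2134 (1 + m) i
    ones≡ = begin
      count d ones                                              ≡⟨ count-map d one⊕ (filterᵇ (avoiders p2134) (perms (1 + m))) ⟩
      count (d ∘ one⊕) (filterᵇ (avoiders p2134) (perms (1 + m))) ≡⟨ count-filterᵇ (d ∘ one⊕) (avoiders p2134) (perms (1 + m)) ⟩
      count (λ w → avoidsᵇ w p2134 ∧ d (one⊕ w)) (perms (1 + m))
        ≡⟨ count-cong (perms (1 + m)) (λ {w} _ → cong (λ k → avoidsᵇ w p2134 ∧ (k ≡ᵇ i)) (des-one⊕ w)) ⟩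
      Acount p2134 (1 + m) i                                    ∎

  total-2134 : ∀ m → count (avoiders p2134) (perms (2 + m)) ≡
    Icount1 p2134 (2 + m) + (count (avoiders p2134) (perms (1 + m)) + sum (map (λ a → Icount1 p213 (2 + m ∸ a)) (oneTo m)))
  total-2134 m = begin
    count (avoiders p2134) (perms n)
      ≡⟨ count-split-total (avoiders p2134) indecᵇ (perms n) ⟩
    Icount1 p2134 n + length (decomposableAvoiders p2134 n)
      ≡⟨ cong (Icount1 p2134 n +_) (trans (↭-length (decomposable-2134 m)) (length-++ ones)) ⟩
    Icount1 p2134 n + (length ones + length (concatMap (runExtensions n) (oneTo m)))
      ≡⟨ cong₂ (λ x y → Icount1 p2134 n + (x + y)) (length-map one⊕ (filterᵇ (avoiders p2134) (perms (1 + m)))) (length-concatMap (runExtensions n) (oneTo m)) ⟩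
    Icount1 p2134 n + (count (avoiders p2134) (perms (1 + m)) + sum (map (length ∘ runExtensions n) (oneTo m)))
      ≡⟨ cong (λ x → Icount1 p2134 n + (count (avoiders p2134) (perms (1 + m)) + sum x))
           (map-cong (λ a → length-map (_++ decreasing (n ∸ a) a) (indecomposableAvoiders p213 (n ∸ a))) (oneTo m)) ⟩
    _ ∎
    where
    open ≡-Reasoning
    n = 2 + m
    ones = map one⊕ (filterᵇ (avoiders p2134) (perms (1 + m)))

  Icount1-213 : ∀ m → Icount1 p213 (2 + m) + Cat (1 + m) ≡ Cat (2 + m)
  Icount1-213 m = begin
    Icount1 p213 (2 + m) + Cat (1 + m)
      ≡⟨ cong (Icount1 p213 (2 + m) +_) (count-213-Cat (1 + m)) ⟨
    Icount1 p213 (2 + m) + count (avoiders p213) (perms (1 + m))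
      ≡⟨ cong (Icount1 p213 (2 + m) +_) (length-map one⊕ (filterᵇ (avoiders p213) (perms (1 + m)))) ⟨
    Icount1 p213 (2 + m) + length (map one⊕ (filterᵇ (avoiders p213) (perms (1 + m))))
      ≡⟨ cong (Icount1 p213 (2 + m) +_) (↭-length (decomposable-213 (1 + m) (s≤s z≤n))) ⟨
    Icount1 p213 (2 + m) + length (decomposableAvoiders p213 (2 + m))
      ≡⟨ count-split-total (avoiders p213) indecᵇ (perms (2 + m)) ⟨
    count (avoiders p213) (perms (2 + m))
      ≡⟨ count-213-Cat (2 + m) ⟩
    Cat (2 + m) ∎
    where open ≡-Reasoning

  -- By `Icount1-213` the summands are C_k - C_{k-1} for k = 2, ..., m + 1. The sum telescopes, and
  -- the added 1 is C_1.
  sum-Icount1-213 : ∀ m → sum (map (λ a → Icount1 p213 (2 + m ∸ a)) (oneTo m)) + 1 ≡ Cat (1 + m)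
  sum-Icount1-213 zero    = refl
  sum-Icount1-213 (suc m) = begin
    sum (map (λ a → Icount1 p213 (3 + m ∸ a)) (oneTo (suc m))) + 1
      -- The new summand is the one of a = 1, at the front, although `oneTo` grows at its end.
      ≡⟨ cong (λ js → sum (map (λ a → Icount1 p213 (3 + m ∸ a)) js) + 1) (oneTo-suc m) ⟩
    Icount1 p213 (2 + m) + sum (map (λ a → Icount1 p213 (3 + m ∸ a)) (map suc (oneTo m))) + 1
      ≡⟨ cong (λ js → Icount1 p213 (2 + m) + sum js + 1) (map-∘ (oneTo m)) ⟨
    Icount1 p213 (2 + m) + sum (map (λ a → Icount1 p213 (2 + m ∸ a)) (oneTo m)) + 1
      ≡⟨ +-assoc (Icount1 p213 (2 + m)) _ 1 ⟩
    Icount1 p213 (2 + m) + (sum (map (λ a → Icount1 p213 (2 + m ∸ a)) (oneTo m)) + 1)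
      ≡⟨ cong (Icount1 p213 (2 + m) +_) (sum-Icount1-213 m) ⟩
    Icount1 p213 (2 + m) + Cat (1 + m)
      ≡⟨ Icount1-213 m ⟩
    Cat (2 + m) ∎
    where open ≡-Reasoning

  -- Subtraction of naturals truncates, so every negative term stands on the opposite side until the
  -- passage to integers.
  E-recurrence : ∀ m → Icount1 p2134 (2 + m) + E (1 + m) + Cat (1 + m) ≡ E (2 + m) + 1
  E-recurrence m = begin
    I + E (1 + m) + Cat (1 + m)                 ≡⟨ cong (I + E (1 + m) +_) (sum-Icount1-213 m) ⟨
    I + E (1 + m) + (S + 1)                     ≡⟨ solve 3 (λ i e s → i :+ e :+ (s :+ con 1) := i :+ (e :+ s) :+ con 1) refl I (E (1 + m)) S ⟩
    I + (E (1 + m) + S) + 1                     ≡⟨ cong (λ e → I + (e + S) + 1) (wilf-1234-2134 (1 + m)) ⟨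
    I + (count (avoiders p2134) (perms (1 + m)) + S) + 1  ≡⟨ cong (_+ 1) (total-2134 m) ⟨
    count (avoiders p2134) (perms (2 + m)) + 1  ≡⟨ cong (_+ 1) (wilf-1234-2134 (2 + m)) ⟩
    E (2 + m) + 1                               ∎
    where
    open ≡-Reasoning
    open +-*-Solver
    I = Icount1 p2134 (2 + m)
    S = sum (map (λ a → Icount1 p213 (2 + m ∸ a)) (oneTo m))

  -- The run supplies a of the i descents, and α the remaining i - a; a ≤ i makes this difference
  -- exact.
  runCount-≤ : ∀ n i a → a ≤ i → suc a < n → runCount n i (suc a) ≡ Icount p213 (n ∸ suc a) (i ∸ a)
  runCount-≤ n i a a≤i a<n = begin
    runCount n i (suc a)
      ≡⟨ count-map _ (_++ decreasing r (suc a)) (indecomposableAvoiders p213 r) ⟩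
    count (λ α → des (α ++ decreasing r (suc a)) ≡ᵇ i) (indecomposableAvoiders p213 r)
      ≡⟨ count-cong (indecomposableAvoiders p213 r) (λ {α} α∈ → trans
           (cong (_≡ᵇ i) (des-++-decreasing α a (m<n⇒0<n∸m a<n) (proj₁ (to (∈-indecomposableAvoiders {n = r}) α∈))))
           (shift-des (des α))) ⟩
    count (λ α → des α ≡ᵇ i ∸ a) (indecomposableAvoiders p213 r)
      ≡⟨ count-filterᵇ _ _ (perms r) ⟩
    count (λ α → (avoidsᵇ α p213 ∧ indecᵇ α) ∧ (des α ≡ᵇ i ∸ a)) (perms r)
      ≡⟨ count-cong (perms r) (λ {α} _ → ∧-assoc (avoidsᵇ α p213) (indecᵇ α) _) ⟩
    Icount p213 r (i ∸ a) ∎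
    where
    open ≡-Reasoning
    r = n ∸ suc a
    shift-des : ∀ k → (k + a ≡ᵇ i) ≡ (k ≡ᵇ i ∸ a)
    shift-des k = T-cong
      (λ h → ≡⇒≡ᵇ k _ (trans (sym (m+n∸n≡m k a)) (cong (_∸ a) (≡ᵇ⇒≡ (k + a) i h))))
      (λ h → ≡⇒≡ᵇ (k + a) i (trans (cong (_+ a) (≡ᵇ⇒≡ k _ h)) (m∸n+n≡m a≤i)))

  runCount-> : ∀ n i a → i < a → suc a < n → runCount n i (suc a) ≡ 0
  runCount-> n i a i<a a<n = trans (count-map _ (_++ decreasing r (suc a)) (indecomposableAvoiders p213 r))
    (count-none (indecomposableAvoiders p213 r) (λ {α} α∈ → trans
       (cong (_≡ᵇ i) (des-++-decreasing α a (m<n⇒0<n∸m a<n) (proj₁ (to (∈-indecomposableAvoiders {n = r}) α∈))))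
       (T-cong {c = false} (λ h → <⇒≢ (<-≤-trans i<a (m≤n+m a (des α))) (sym (≡ᵇ⇒≡ (des α + a) i h))) (λ ()))))
    where r = n ∸ suc a

module GeneratingSeries where

  open AvoidingPermutations
  open import Data.Bool using (Bool; true; false; T)
  open import Data.Bool.Properties using (T-≡)
  open import Data.Integer as ℤ using (ℤ; +_)
  import Data.Integer.Properties as ℤₚ
  import Data.Integer.Solver as ℤ-Solver
  open import Data.List using (List; map; []; _∷_; _∷ʳ_)
  open import Data.List.Properties using (map-++)
  open import Data.Nat using (ℕ; zero; suc; _+_; _∸_; _≤_; _<_; z≤n; s≤s; s≤s⁻¹; _≟_; _≤?_; _≡ᵇ_)
  open import Data.Nat.ListAction using (sum)
  open import Data.Nat.ListAction.Properties using (sum-++)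
  open import Data.Nat.Properties
  open import Data.Product using (_×_; _,_)
  open import Function using (_∘_; Equivalence)
  open import Relation.Nullary using (¬_; yes; no; contradiction)
  open import Relation.Binary.PropositionalEquality
  open Equivalence using (to; from)

  -- Integer sums and products of series

  Σ≤-zero : ∀ n {f} → (∀ j → f j ≡ + 0) → Σ≤ n f ≡ + 0
  Σ≤-zero zero    h = h 0
  Σ≤-zero (suc n) h = cong₂ ℤ._+_ (Σ≤-zero n h) (h (suc n))

  Σ≤-cong : ∀ n {f g} → (∀ j → f j ≡ g j) → Σ≤ n f ≡ Σ≤ n g
  Σ≤-cong zero    h = h 0
  Σ≤-cong (suc n) h = cong₂ ℤ._+_ (Σ≤-cong n h) (h (suc n))

  Σ≤-single : ∀ n {f} k → k ≤ n → (∀ j → j ≢ k → f j ≡ + 0) → Σ≤ n f ≡ f k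
  Σ≤-outside : ∀ n {f} k → n < k → (∀ j → j ≢ k → f j ≡ + 0) → Σ≤ n f ≡ + 0
  Σ≤-outside zero    k n<k h = h 0 (<⇒≢ n<k)
  Σ≤-outside (suc n) k n<k h = cong₂ ℤ._+_ (Σ≤-outside n k (<⇒≤ n<k) h) (h (suc n) (<⇒≢ n<k))

  Σ≤-single zero    zero _   h = refl
  Σ≤-single (suc n) {f} k k≤ h with k ≟ suc n
  ... | yes refl = trans (cong (ℤ._+ f (suc n)) (Σ≤-outside n (suc n) ≤-refl h)) (ℤₚ.+-identityˡ (f (suc n)))
  ... | no  k≢   = trans (cong₂ ℤ._+_ (Σ≤-single n k (s≤s⁻¹ (≤∧≢⇒< k≤ k≢)) h) (h (suc n) (k≢ ∘ sym))) (ℤₚ.+-identityʳ (f k))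

  Σ≤-two : ∀ n {f} → (∀ j → f (2 + j) ≡ + 0) → Σ≤ (suc n) f ≡ f 0 ℤ.+ f 1
  Σ≤-two zero    h = refl
  Σ≤-two (suc n) h = trans (cong₂ ℤ._+_ (Σ≤-two n h) (h n)) (ℤₚ.+-identityʳ _)

  δ-≢ : ∀ {m n} → m ≢ n → δ m n ≡ + 0
  δ-≢ {m} {n} m≢n with m ≡ᵇ n in eq
  ... | false = refl
  ... | true  = contradiction (≡ᵇ⇒≡ m n (from T-≡ eq)) m≢n

  δ-refl : ∀ n → δ n n ≡ + 1
  δ-refl n with n ≡ᵇ n in eq
  ... | true  = refl
  ... | false = contradiction (≡⇒≡ᵇ n n refl) (subst (¬_ ∘ T) (sym eq) (λ ()))

  Σ≤-δ : ∀ i k (f : ℕ → ℤ) → k ≤ i → Σ≤ i (λ b → δ k b ℤ.* f b) ≡ f k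
  Σ≤-δ i k f k≤i = trans (Σ≤-single i k k≤i (λ b b≢k → cong (ℤ._* f b) (δ-≢ (b≢k ∘ sym))))
    (trans (cong (ℤ._* f k) (δ-refl k)) (ℤₚ.*-identityˡ (f k)))

  Σ≤-δ-outside : ∀ i k (f : ℕ → ℤ) → i < k → Σ≤ i (λ b → δ k b ℤ.* f b) ≡ + 0
  Σ≤-δ-outside i k f i<k = Σ≤-outside i k i<k (λ b b≢k → cong (ℤ._* f b) (δ-≢ (b≢k ∘ sym)))

  x₂-*-zero : ∀ f i → (x₂ *₂ f) 0 i ≡ + 0
  x₂-*-zero f i = Σ≤-zero i (λ b → refl)

  x₂-*-suc : ∀ f n i → (x₂ *₂ f) (suc n) i ≡ f n i
  x₂-*-suc f n i = begin
    (x₂ *₂ f) (suc n) i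
      ≡⟨ Σ≤-single (suc n) 1 (s≤s z≤n) (λ a a≢1 → Σ≤-zero i (λ b →
           cong (λ c → c ℤ.* δ b 0 ℤ.* f (suc n ∸ a) (i ∸ b)) (δ-≢ a≢1))) ⟩
    Σ≤ i (λ b → + 1 ℤ.* δ b 0 ℤ.* f n (i ∸ b))
      ≡⟨ Σ≤-single i 0 z≤n (λ b b≢0 → cong (λ c → + 1 ℤ.* c ℤ.* f n (i ∸ b)) (δ-≢ b≢0)) ⟩
    + 1 ℤ.* f n i
      ≡⟨ ℤₚ.*-identityˡ (f n i) ⟩
    f n i ∎
    where open ≡-Reasoning

  -- The series of the components α: subtracting x removes the permutation 1.
  longComponents : Ser2
  longComponents = I2 p213 -₂ x₂

  longComponents-1 : ∀ i → longComponents 1 i ≡ + 0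
  longComponents-1 zero    = refl
  longComponents-1 (suc i) = refl

  longComponents-≥2 : ∀ {r} i → 2 ≤ r → longComponents r i ≡ + Icount p213 r i
  longComponents-≥2 {suc (suc r)} i _ = ℤₚ.+-identityʳ _
  longComponents-≥2 {suc zero} i (s≤s ())

  module _ (i : ℕ) where

    private
      -- The share of the coefficient of x^n q^i in which x / (1 - xq) contributes x^a, that is, a
      -- run of length a.
      row : ℕ → ℕ → ℤ
      row n a = Σ≤ i (λ b → (x₂ *₂ invOneMinusXQ) a b ℤ.* longComponents (n ∸ a) (i ∸ b))

    row-zero : ∀ n → row n 0 ≡ + 0
    row-zero n = Σ≤-zero i (λ b → cong (ℤ._* longComponents n (i ∸ b)) (x₂-*-zero invOneMinusXQ b))

    row-suc : ∀ n a → row n (suc a) ≡ Σ≤ i (λ b → δ a b ℤ.* longComponents (n ∸ suc a) (i ∸ b))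
    row-suc n a = Σ≤-cong i (λ b → cong (ℤ._* longComponents (n ∸ suc a) (i ∸ b)) (x₂-*-suc invOneMinusXQ a b))

    row-vanishes : ∀ n a → (∀ j → longComponents (n ∸ a) j ≡ + 0) → row n a ≡ + 0
    row-vanishes n a h = Σ≤-zero i (λ b → trans (cong ((x₂ *₂ invOneMinusXQ) a b ℤ.*_) (h (i ∸ b))) (ℤₚ.*-zeroʳ ((x₂ *₂ invOneMinusXQ) a b)))

    -- For a fixed run length the convolution in q has a single nonzero factor, at q^a. If a > i it
    -- is out of range, in agreement with the run alone having more than i descents.
    row-run : ∀ m a → suc a ≤ m → row (2 + m) (suc a) ≡ + runCount (2 + m) i (suc a)
    row-run m a a<m with a ≤? i
    ... | yes a≤i = begin
      row (2 + m) (suc a)                                  ≡⟨ row-suc (2 + m) a ⟩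
      Σ≤ i (λ b → δ a b ℤ.* longComponents r (i ∸ b))      ≡⟨ Σ≤-δ i a (λ b → longComponents r (i ∸ b)) a≤i ⟩
      longComponents r (i ∸ a)                             ≡⟨ longComponents-≥2 (i ∸ a) (m+n≤o⇒m≤o∸n 2 (s≤s (s≤s a<m))) ⟩
      + Icount p213 r (i ∸ a)                              ≡⟨ cong +_ (runCount-≤ (2 + m) i a a≤i (s≤s (m≤n⇒m≤1+n a<m))) ⟨
      + runCount (2 + m) i (suc a)                         ∎
      where
      open ≡-Reasoning
      r = 2 + m ∸ suc a
    ... | no a≰i = trans (row-suc (2 + m) a) (trans
      (Σ≤-δ-outside i a (λ b → longComponents (2 + m ∸ suc a) (i ∸ b)) (≰⇒> a≰i))
      (cong +_ (sym (runCount-> (2 + m) i a (≰⇒> a≰i) (s≤s (m≤n⇒m≤1+n a<m))))))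

    sum-oneTo : ∀ m (f : ℕ → ℤ) (g : ℕ → ℕ) → f 0 ≡ + 0 → (∀ a → suc a ≤ m → f (suc a) ≡ + g (suc a)) →
      Σ≤ m f ≡ + sum (map g (oneTo m))
    sum-oneTo zero    f g h₀ h = h₀
    sum-oneTo (suc m) f g h₀ h = begin
      Σ≤ m f ℤ.+ f (suc m)                           ≡⟨ cong₂ ℤ._+_ (sum-oneTo m f g h₀ (λ a a≤ → h a (m≤n⇒m≤1+n a≤))) (h m ≤-refl) ⟩
      + (sum (map g (oneTo m)) + g (suc m))          ≡⟨ cong (λ x → + (sum (map g (oneTo m)) + x)) (+-identityʳ (g (suc m))) ⟨
      + (sum (map g (oneTo m)) + (g (suc m) + 0))    ≡⟨ cong +_ (sum-++ (map g (oneTo m)) (g (suc m) ∷ [])) ⟨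
      + sum (map g (oneTo m) ∷ʳ g (suc m))           ≡⟨ cong (+_ ∘ sum) (map-++ g (oneTo m) (suc m ∷ [])) ⟨
      + sum (map g (oneTo (suc m)))                  ∎
      where open ≡-Reasoning

    runs-zero : ((x₂ *₂ invOneMinusXQ) *₂ longComponents) 0 i ≡ + 0
    runs-zero = row-zero 0

    runs-one : ((x₂ *₂ invOneMinusXQ) *₂ longComponents) 1 i ≡ + 0
    runs-one = cong₂ ℤ._+_ (row-zero 1) (row-vanishes 1 1 (λ _ → refl))

    runs-≥2 : ∀ m → ((x₂ *₂ invOneMinusXQ) *₂ longComponents) (2 + m) i ≡ + sum (map (runCount (2 + m) i) (oneTo m))
    runs-≥2 m = begin
      Σ≤ m (row (2 + m)) ℤ.+ row (2 + m) (1 + m) ℤ.+ row (2 + m) (2 + m)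
        -- Runs of m + 1 or m + 2 letters would leave a component of length 1 or 0, where
        -- `longComponents` vanishes.
        ≡⟨ cong₂ (λ x y → Σ≤ m (row (2 + m)) ℤ.+ x ℤ.+ y)
             (row-vanishes (2 + m) (1 + m) (λ j → trans (cong (λ r → longComponents r j) (m+n∸n≡m 1 m)) (longComponents-1 j)))
             (row-vanishes (2 + m) (2 + m) (λ j → cong (λ r → longComponents r j) (n∸n≡0 m))) ⟩
      Σ≤ m (row (2 + m)) ℤ.+ + 0 ℤ.+ + 0
        ≡⟨ trans (ℤₚ.+-identityʳ _) (ℤₚ.+-identityʳ _) ⟩
      Σ≤ m (row (2 + m))
        ≡⟨ sum-oneTo m (row (2 + m)) (runCount (2 + m) i) (row-zero (2 + m)) (row-run m) ⟩
      + sum (map (runCount (2 + m) i) (oneTo m)) ∎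
      where open ≡-Reasoning

  -- The decomposition speaks of lengths from 2 on; the coefficients of lengths 0 and 1 are
  -- evaluated.
  bivariate-identity : A2 p2134 ≈₂ one₂ +₂ I2 p2134 +₂ x₂ *₂ (A2 p2134 -₂ one₂)
                         +₂ (x₂ *₂ invOneMinusXQ) *₂ (I2 p213 -₂ x₂)
  bivariate-identity zero i = trans (initial i)
    (sym (cong₂ (λ x y → one₂ 0 i ℤ.+ + 0 ℤ.+ x ℤ.+ y) (x₂-*-zero (A2 p2134 -₂ one₂) i) (runs-zero i)))
    where
    initial : ∀ i → δ i 0 ≡ one₂ 0 i ℤ.+ + 0 ℤ.+ + 0 ℤ.+ + 0
    initial zero    = refl
    initial (suc i) = refl
  bivariate-identity (suc zero) i = trans (singleton i)
    (sym (cong₂ (λ x y → one₂ 1 i ℤ.+ I2 p2134 1 i ℤ.+ x ℤ.+ y) (x₂-*-suc (A2 p2134 -₂ one₂) 0 i) (runs-one i)))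
    where
    singleton : ∀ i → A2 p2134 1 i ≡ one₂ 1 i ℤ.+ I2 p2134 1 i ℤ.+ (A2 p2134 0 i ℤ.- one₂ 0 i) ℤ.+ + 0
    singleton zero    = refl
    singleton (suc i) = refl
  bivariate-identity (suc (suc m)) i = begin
    + Acount p2134 (2 + m) i
      ≡⟨ cong +_ (Acount-2134 m i) ⟩
    + (I + (A′ + S))
      -- The 0 beside `A′` is the coefficient of `one₂` subtracted from `A2 p2134`; written this
      -- way, the sum matches the series by computation.
      ≡⟨ cong +_ (trans (sym (+-assoc I A′ S)) (cong (λ x → I + x + S) (sym (+-identityʳ A′)))) ⟩
    + (I + (A′ + 0) + S)
      ≡⟨ cong₂ (λ x y → + I ℤ.+ x ℤ.+ y) (x₂-*-suc (A2 p2134 -₂ one₂) (1 + m) i) (runs-≥2 i m) ⟨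
    _ ∎
    where
    open ≡-Reasoning
    I  = Icount p2134 (2 + m) i
    A′ = Acount p2134 (1 + m) i
    S  = sum (map (runCount (2 + m) i) (oneTo m))

  -- The univariate identity and the closed form

  E-recurrence-ℤ : ∀ m → + Icount1 p2134 (2 + m) ≡ + E (2 + m) ℤ.- + E (1 + m) ℤ.- + Cat (1 + m) ℤ.+ + 1
  E-recurrence-ℤ m = begin
    I                                     ≡⟨ solve 3 (λ i e c → i := i :+ e :+ c :- e :- c) refl I e′ c ⟩
    I ℤ.+ e′ ℤ.+ c ℤ.- e′ ℤ.- c           ≡⟨ cong (λ z → z ℤ.- e′ ℤ.- c) (cong +_ (E-recurrence m)) ⟩
    e ℤ.+ + 1 ℤ.- e′ ℤ.- c                ≡⟨ solve 3 (λ e e′ c → e :+ con (+ 1) :- e′ :- c := e :- e′ :- c :+ con (+ 1)) refl e e′ c ⟩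
    e ℤ.- e′ ℤ.- c ℤ.+ + 1                ∎
    where
    open ≡-Reasoning
    open ℤ-Solver.+-*-Solver
    I  = + Icount1 p2134 (2 + m)
    e  = + E (2 + m)
    e′ = + E (1 + m)
    c  = + Cat (1 + m)

  one-x₁-* : ∀ f n → ((one₁ -₁ x₁) *₁ f) (suc n) ≡ + 1 ℤ.* f (suc n) ℤ.+ ℤ.- + 1 ℤ.* f n
  one-x₁-* f n = Σ≤-two n (λ j → refl)

  x₁-*-suc : ∀ f n → (x₁ *₁ f) (suc n) ≡ f n
  x₁-*-suc f n = trans (Σ≤-two n (λ j → refl)) (trans (ℤₚ.+-identityˡ _) (ℤₚ.*-identityˡ (f n)))

  x₁²-inv : ∀ m → ((x₁ *₁ x₁) *₁ invOneMinusX) (2 + m) ≡ + 1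
  x₁²-inv m = Σ≤-single (2 + m) {λ a → (x₁ *₁ x₁) a ℤ.* + 1} 2 (s≤s (s≤s z≤n)) off
    where
    off : ∀ a → a ≢ 2 → (x₁ *₁ x₁) a ℤ.* + 1 ≡ + 0
    off zero          a≢2 = refl
    off (suc a) a≢2 = cong (ℤ._* + 1) (trans (x₁-*-suc x₁ a) (δ-≢ (a≢2 ∘ cong suc)))

  -- From length 2 on the terms 1 and 2x vanish and x^2 / (1 - x) supplies the 1 of the recurrence;
  -- at lengths 0 and 1, where 1 and 2x act as corrections, both sides compute.
  univariate-identity : I1 p2134 ≈₁ (one₁ -₁ x₁) *₁ Eser -₁ x₁ *₁ Cser -₁ one₁ +₁ (x₁ +₁ x₁)
                          +₁ (x₁ *₁ x₁) *₁ invOneMinusX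
  univariate-identity zero          = refl
  univariate-identity (suc zero)    = refl
  univariate-identity (suc (suc m)) = begin
    + Icount1 p2134 (2 + m)
      ≡⟨ E-recurrence-ℤ m ⟩
    e ℤ.- e′ ℤ.- c ℤ.+ + 1
      ≡⟨ solve 3 (λ e e′ c → e :- e′ :- c :+ con (+ 1) :=
           (con (+ 1) :* e :+ con (ℤ.- + 1) :* e′) :- c :- con (+ 0) :+ con (+ 0) :+ con (+ 1)) refl e e′ c ⟩
    (+ 1 ℤ.* e ℤ.+ ℤ.- + 1 ℤ.* e′) ℤ.- c ℤ.- + 0 ℤ.+ + 0 ℤ.+ + 1
      ≡⟨ cong₂ (λ x y → x ℤ.- y ℤ.- + 0 ℤ.+ + 0 ℤ.+ + 1) (one-x₁-* Eser (1 + m)) (x₁-*-suc Cser (1 + m)) ⟨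
    ((one₁ -₁ x₁) *₁ Eser) (2 + m) ℤ.- (x₁ *₁ Cser) (2 + m) ℤ.- + 0 ℤ.+ + 0 ℤ.+ + 1
      ≡⟨ cong (λ z → ((one₁ -₁ x₁) *₁ Eser) (2 + m) ℤ.- (x₁ *₁ Cser) (2 + m) ℤ.- + 0 ℤ.+ + 0 ℤ.+ z) (x₁²-inv m) ⟨
    _ ∎
    where
    open ≡-Reasoning
    open ℤ-Solver.+-*-Solver
    e  = + E (2 + m)
    e′ = + E (1 + m)
    c  = + Cat (1 + m)

  Icount1-≥2 : ∀ n → 2 ≤ n → + Icount1 p2134 n ≡ + E n ℤ.- + E (n ∸ 1) ℤ.- + Cat (n ∸ 1) ℤ.+ + 1
  Icount1-≥2 (suc (suc m)) _ = E-recurrence-ℤ m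
  Icount1-≥2 (suc zero) (s≤s ())

open import Data.Nat using (ℕ; suc; _≤_)
open import Data.Integer using (+_; _+_; _-_)
open import Data.Product using (_×_; _,_)
open import Relation.Binary.PropositionalEquality using (_≡_; refl)

theorem3p15 : (A2 p2134 ≈₂ one₂ +₂ I2 p2134 +₂ x₂ *₂ (A2 p2134 -₂ one₂)
    +₂ (x₂ *₂ invOneMinusXQ) *₂ (I2 p213 -₂ x₂))
    × (I1 p2134 ≈₁ (one₁ -₁ x₁) *₁ Eser -₁ x₁ *₁ Cser -₁ one₁ +₁ (x₁ +₁ x₁)
    +₁ (x₁ *₁ x₁) *₁ invOneMinusX)
    × (Icount1 p2134 1 ≡ 1)
    × ((n : ℕ) → 2 ≤ n → + Icount1 p2134 n ≡ + E n - + E (n Data.Nat.∸ 1) - + Cat (n Data.Nat.∸ 1) + + 1)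
theorem3p15 = bivariate-identity , univariate-identity , refl , Icount1-≥2
  where open GeneratingSeries
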